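{- There exists a constant $c_3 > 0$ such that the following holds for all positive integers $n$. Let $b$ be a positive integer such that $\log n \leq b \leq \frac{n}{(\log n)^2}$ and define, for $1 \leq i \leq n$, $a_i = 2i$ if $b \mid i$ and $a_i = 2i-1$ otherwise. Then $|S(a)| \geq c_3 n^2$.
   Context: For a finite sequence of integers $a = (a_i)_{1 \leq i \leq k}$, $S(a) = \{\sum_{i=u}^{v} a_i \mid 1 \leq u \leq v \leq k\}$ is the set of its consecutive sums. -}

module Defs where

open import Data.Nat as ℕ using (ℕ; zero; suc; _∸_)
open import Data.Nat.Divisibility using (_∣?_)
open import Data.Integer using (+_)
open import Data.Rational using (ℚ; 0ℚ; 1ℚ; _/_; _≤_)
import Data.Rational as ℚ
open import Data.Nat.ListAction using (sum)
open import Data.List using (List; []; _∷_; map; upTo; concatMap; length; deduplicate)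
open import Data.Product using (Σ; ∃; _×_)
open import Relation.Nullary using (Dec; yes; no)

ℕ→ℚ : ℕ → ℚ
ℕ→ℚ n = + n / 1

-- Consecutive sums of a finite sequence (a_1,…,a_k), given as a
-- function ℕ → ℕ whose values at 1..k are used.

sumFromTo : (ℕ → ℕ) → ℕ → ℕ → ℕ
sumFromTo a u v = sum (map (λ j → a (u ℕ.+ j)) (upTo (suc v ∸ u)))

consecSumList : (ℕ → ℕ) → ℕ → List ℕ
consecSumList a k =
  concatMap (λ u → map (λ v → sumFromTo a u v) (map (u ℕ.+_) (upTo (suc k ∸ u))))
            (map suc (upTo k))

cardS : (ℕ → ℕ) → ℕ → ℕ
cardS a k = length (deduplicate ℕ._≟_ (consecSumList a k))

seqA : ℕ → ℕ → ℕ
seqA b i with b ∣? i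
... | yes _ = 2 ℕ.* i
... | no  _ = 2 ℕ.* i ∸ 1

expTerm : ℚ → ℕ → ℚ
expTerm q zero    = 1ℚ
expTerm q (suc k) = expTerm q k ℚ.* q ℚ.* (+ 1 / suc k)

expPartial : ℚ → ℕ → ℚ
expPartial q zero    = 1ℚ
expPartial q (suc K) = expPartial q K ℚ.+ expTerm q (suc K)

-- For rational r ≥ 0 and n ≥ 1:  log n ≤ r  (natural log)
-- expressed as  n ≤ e^r  =  sup_K expPartial r K.
-- (Since e^r is irrational for rational r > 0, and e^0 = 1 is attained at
--  K = 0, "n ≤ e^r" is equivalent to "n ≤ some partial sum".)
LogLe : ℕ → ℚ → Set
LogLe n r = ∃ λ K → ℕ→ℚ n ≤ expPartial r K

-- For n ≥ 1, b ≥ 1:   b ≤ n / (log n)^2, read as  b · (log n)^2 ≤ n,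
-- i.e.  log n ≤ √(n/b), expressed as: there is a rational q ≥ 0 with
-- b q² ≤ n and log n ≤ q.
UpperCond : ℕ → ℕ → Set
UpperCond n b = ∃ λ q → (0ℚ ≤ q) × (ℕ→ℚ b ℚ.* q ℚ.* q ≤ ℕ→ℚ n) × LogLe n q

{-# OPTIONS --safe #-}
-- The sum of a over a window u+1, …, u+d is d(2u + d) + ⌊(u+d)/b⌋ − ⌊u/b⌋ = d(2u + d) + ⌊d/b⌋ + e
-- with a carry e ∈ {0, 1}.  Put N = ⌊n/3⌋ and take d ∈ [N, 2N), u ∈ [0, N).  By Cauchy–Schwarz it
-- suffices that these N² sums have O(N²) coincidences.  For lengths d, d′ with gcd g, coincidences
-- occur only if ⌊d/b⌋ + e ≡ ⌊d′/b⌋ + e′ (mod g), and then the possible u lie in one class modulo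
-- d′/g, so there are at most 2g of them for each (e, e′).  For fixed d and g, writing d′ = qb + ρ
-- shows that at most (Q/g + 1)(b/g + 1) values d′ qualify, where Q ≈ 2N/b.  Since g ∣ d saves a
-- factor g, the coincidences number O(N) · Σ_{g ≤ 2N} (Q/g + 1)(b/g + 1), that is
-- O(N) · (N + (Q + b) log n), and b ≥ log n together with b log n ≤ n makes this O(N²).
-- The hypotheses on log n enter through e^q ≤ 4^m for q ≤ m, obtained by comparing the exponential
-- series with that of (1 − x)^(−2m) at x = ½.
module Submission where

open import Defs
import Data.Nat as ℕ
open import Data.Nat.Divisibility using (_∣_; _∣?_; divides; ∣⇒≤; n∣m*n*o; n∣m⇒m%n≡0)
open import Data.Nat.GCD using (gcd; gcd[m,n]∣m; gcd[m,n]∣n; gcd[m,n]≢0)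
open import Data.Nat.Coprimality as Coprimality using (Coprime; coprime-divisor; coprime-/gcd)
open import Data.Nat.ListAction using (sum)
open import Data.Nat.ListAction.Properties using (sum-++)
open import Data.Nat.Tactic.RingSolver using (solve-∀)
open import Data.List using (List; []; _∷_; _++_; map; length; upTo; downFrom; cartesianProduct; deduplicate)
open import Data.List.Properties using (map-++; map-∘; length-++; length-map; length-downFrom; upTo-∷ʳ)
open import Data.List.Membership.Propositional using (_∈_; lose)
open import Data.List.Membership.Propositional.Properties using (∈-map⁺; ∈-concatMap⁺; ∈-upTo⁺; ∈-downFrom⁺; ∈-downFrom⁻; ∈-cartesianProduct⁺; ∈-cartesianProduct⁻; ∈-deduplicate⁺)
open import Data.List.Relation.Unary.Any using (here; there)
import Data.List.Relation.Unary.All as All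
open import Data.List.Relation.Unary.AllPairs using ([]; _∷_)
open import Data.List.Relation.Unary.Unique.Propositional using (Unique)
open import Data.Product using (Σ; ∃; _×_; _,_; proj₁; proj₂)
open import Data.Sum using (inj₁; inj₂)
open import Relation.Nullary using (Dec; yes; no; contradiction)
open import Relation.Binary.PropositionalEquality

module ConsecutiveSums where

  open import Data.Nat
  open import Data.Nat.Properties
  open import Data.Nat.DivMod
  open import Data.List.Relation.Unary.Unique.DecPropositional.Properties _≟_ using (deduplicate-!)

  private variable
    A B : Set

  -- Finite sums over lists and initial segments.

  ∑ : List A → (A → ℕ) → ℕ
  ∑ xs f = sum (map f xs)

  ∑< : ℕ → (ℕ → ℕ) → ℕ
  ∑< n = ∑ (downFrom n)

  ∑-mono : ∀ (xs : List A) {f g : A → ℕ} → (∀ {x} → x ∈ xs → f x ≤ g x) → ∑ xs f ≤ ∑ xs g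
  ∑-mono []       f≤g = z≤n
  ∑-mono (x ∷ xs) f≤g = +-mono-≤ (f≤g (here refl)) (∑-mono xs (λ p → f≤g (there p)))

  ∑<-mono : ∀ n {f g : ℕ → ℕ} → (∀ {i} → i < n → f i ≤ g i) → ∑< n f ≤ ∑< n g
  ∑<-mono n f≤g = ∑-mono (downFrom n) (λ p → f≤g (∈-downFrom⁻ p))

  ∑-cong : ∀ (xs : List A) {f g : A → ℕ} → (∀ x → f x ≡ g x) → ∑ xs f ≡ ∑ xs g
  ∑-cong []       f≡g = refl
  ∑-cong (x ∷ xs) f≡g = cong₂ _+_ (f≡g x) (∑-cong xs f≡g)

  ∑-+ : ∀ (xs : List A) (f g : A → ℕ) → ∑ xs (λ x → f x + g x) ≡ ∑ xs f + ∑ xs g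
  ∑-+ []       f g = refl
  ∑-+ (x ∷ xs) f g = trans (cong (f x + g x +_) (∑-+ xs f g)) (interchange (f x) (g x) (∑ xs f) (∑ xs g))
    where
    interchange : ∀ p q r s → p + q + (r + s) ≡ p + r + (q + s)
    interchange = solve-∀

  ∑-*ˡ : ∀ (xs : List A) c (f : A → ℕ) → ∑ xs (λ x → c * f x) ≡ c * ∑ xs f
  ∑-*ˡ []       c f = sym (*-zeroʳ c)
  ∑-*ˡ (x ∷ xs) c f = trans (cong (c * f x +_) (∑-*ˡ xs c f)) (sym (*-distribˡ-+ c (f x) (∑ xs f)))

  ∑-*ʳ : ∀ (xs : List A) (f : A → ℕ) c → ∑ xs (λ x → f x * c) ≡ ∑ xs f * c
  ∑-*ʳ xs f c = trans (∑-cong xs (λ x → *-comm (f x) c)) (trans (∑-*ˡ xs c f) (*-comm c (∑ xs f)))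

  ∑-const : ∀ (xs : List A) c → ∑ xs (λ _ → c) ≡ length xs * c
  ∑-const []       c = refl
  ∑-const (x ∷ xs) c = cong (c +_) (∑-const xs c)

  ∑-swap : ∀ (xs : List A) (ys : List B) (f : A → B → ℕ) →
           ∑ xs (λ x → ∑ ys (f x)) ≡ ∑ ys (λ y → ∑ xs (λ x → f x y))
  ∑-swap []       ys f = sym (trans (∑-const ys 0) (*-zeroʳ (length ys)))
  ∑-swap (x ∷ xs) ys f = trans (cong (∑ ys (f x) +_) (∑-swap xs ys f))
                               (sym (∑-+ ys (f x) (λ y → ∑ xs (λ z → f z y))))

  ∑-++ : ∀ (xs ys : List A) (f : A → ℕ) → ∑ (xs ++ ys) f ≡ ∑ xs f + ∑ ys f
  ∑-++ xs ys f = trans (cong sum (map-++ f xs ys)) (sum-++ (map f xs) (map f ys))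

  ∑-cartesianProduct : ∀ (xs : List A) (ys : List B) (f : A × B → ℕ) →
                       ∑ (cartesianProduct xs ys) f ≡ ∑ xs (λ x → ∑ ys (λ y → f (x , y)))
  ∑-cartesianProduct []       ys f = refl
  ∑-cartesianProduct (x ∷ xs) ys f =
    trans (∑-++ (map (x ,_) ys) (cartesianProduct xs ys) f)
          (cong₂ _+_ (cong sum (sym (map-∘ ys))) (∑-cartesianProduct xs ys f))

  length-cartesianProduct : ∀ (xs : List A) (ys : List B) →
                            length (cartesianProduct xs ys) ≡ length xs * length ys
  length-cartesianProduct []       ys = refl
  length-cartesianProduct (x ∷ xs) ys =
    trans (length-++ (map (x ,_) ys))
          (cong₂ _+_ (length-map (x ,_) ys) (length-cartesianProduct xs ys))

  term≤∑ : ∀ {xs : List A} (f : A → ℕ) {x} → x ∈ xs → f x ≤ ∑ xs f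
  term≤∑ f (here refl) = m≤m+n _ _
  term≤∑ f (there p)   = ≤-trans (term≤∑ f p) (m≤n+m _ _)

  ∑-positive : ∀ (xs : List A) {f : A → ℕ} → 0 < ∑ xs f → ∃ λ x → 0 < f x
  ∑-positive (x ∷ xs) {f} p with f x in eq
  ... | suc _ = x , subst (0 <_) (sym eq) z<s
  ... | zero  = ∑-positive xs p

  ∑<-split : ∀ m n (f : ℕ → ℕ) → ∑< (n + m) f ≡ ∑< m f + ∑< n (λ i → f (m + i))
  ∑<-split m zero    f = sym (+-identityʳ _)
  ∑<-split m (suc n) f = begin
    f (n + m) + ∑< (n + m) f                    ≡⟨ cong₂ _+_ (cong f (+-comm n m)) (∑<-split m n f) ⟩
    f (m + n) + (∑< m f + ∑< n (λ i → f (m + i))) ≡⟨ rearrange (f (m + n)) (∑< m f) _ ⟩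
    ∑< m f + (f (m + n) + ∑< n (λ i → f (m + i))) ∎
    where
    open ≡-Reasoning
    rearrange : ∀ p q r → p + (q + r) ≡ q + (p + r)
    rearrange = solve-∀

  ∑<-monoˡ : ∀ {m n} (f : ℕ → ℕ) → m ≤ n → ∑< m f ≤ ∑< n f
  ∑<-monoˡ {m} {n} f m≤n = subst (λ k → ∑< m f ≤ ∑< k f) (m∸n+n≡m m≤n)
    (≤-trans (m≤m+n _ _) (≤-reflexive (sym (∑<-split m (n ∸ m) f))))

  ∑<-blocks : ∀ q b (f : ℕ → ℕ) → ∑< (q * b) f ≡ ∑< q (λ i → ∑< b (λ ρ → f (i * b + ρ)))
  ∑<-blocks zero    b f = refl
  ∑<-blocks (suc q) b f = begin
    ∑< (b + q * b) f                               ≡⟨ ∑<-split (q * b) b f ⟩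
    ∑< (q * b) f + ∑< b (λ ρ → f (q * b + ρ))      ≡⟨ +-comm (∑< (q * b) f) _ ⟩
    ∑< b (λ ρ → f (q * b + ρ)) + ∑< (q * b) f      ≡⟨ cong (∑< b (λ ρ → f (q * b + ρ)) +_) (∑<-blocks q b f) ⟩
    ∑< (suc q) (λ i → ∑< b (λ ρ → f (i * b + ρ)))  ∎
    where open ≡-Reasoning

  -- Indicators and counting of separated sets.

  𝟙 : Dec A → ℕ
  𝟙 (yes _) = 1
  𝟙 (no _)  = 0

  𝟙≤1 : (d : Dec A) → 𝟙 d ≤ 1
  𝟙≤1 (yes _) = ≤-refl
  𝟙≤1 (no _)  = z≤n

  𝟙-yes : (d : Dec A) → A → 1 ≤ 𝟙 d
  𝟙-yes (yes _) _ = ≤-refl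
  𝟙-yes (no ¬a) a = contradiction a ¬a

  𝟙-true : (d : Dec A) → 0 < 𝟙 d → A
  𝟙-true (yes a) _ = a

  𝟙-mono : (d : Dec A) {m : ℕ} → (A → 1 ≤ m) → 𝟙 d ≤ m
  𝟙-mono (yes a) h = h a
  𝟙-mono (no _)  h = z≤n

  -- The induction replaces the bound M by the largest point of the support.
  ∑<-separated-≤ : ∀ (h : ℕ → ℕ) g → (∀ x → h x ≤ 1) →
                   (∀ {x y} → x < y → 0 < h x → 0 < h y → x + g ≤ y) →
                   ∀ n M → (∀ {x} → x < n → 0 < h x → x + g ≤ M) → g * ∑< n h ≤ M
  ∑<-separated-≤ h g h≤1 sep zero    M bd = subst (_≤ M) (sym (*-zeroʳ g)) z≤n
  ∑<-separated-≤ h g h≤1 sep (suc n) M bd with h n in eq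
  ... | zero  = ∑<-separated-≤ h g h≤1 sep n M (λ x<n → bd (m<n⇒m<1+n x<n))
  ... | suc r = begin
    g * (suc r + ∑< n h)   ≤⟨ *-monoʳ-≤ g (+-monoˡ-≤ _ (subst (_≤ 1) eq (h≤1 n))) ⟩
    g * (1 + ∑< n h)       ≡⟨ *-distribˡ-+ g 1 _ ⟩
    g * 1 + g * ∑< n h     ≡⟨ cong (_+ g * ∑< n h) (*-identityʳ g) ⟩
    g + g * ∑< n h         ≤⟨ +-monoʳ-≤ g (∑<-separated-≤ h g h≤1 sep n n (λ x<n hx → sep x<n hx hn)) ⟩
    g + n                  ≡⟨ +-comm g n ⟩
    n + g                  ≤⟨ bd (n<1+n n) hn ⟩
    M                      ∎
    where
    open ≤-Reasoning
    hn : 0 < h n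
    hn = subst (0 <_) (sym eq) z<s

  ∑<-separated : ∀ (h : ℕ → ℕ) g → (∀ x → h x ≤ 1) →
                 (∀ {x y} → x < y → 0 < h x → 0 < h y → x + g ≤ y) →
                 ∀ n → g * ∑< n h ≤ n + g
  ∑<-separated h g h≤1 sep n =
    ∑<-separated-≤ h g h≤1 sep n (n + g) (λ x<n _ → +-monoˡ-≤ g (<⇒≤ x<n))

  -- With at most one support point every gap condition is vacuous; the gap n + 1 gives (n + 1)S ≤
  -- 2n + 1 and hence S < 2.
  ∑<-unique : ∀ (h : ℕ → ℕ) → (∀ x → h x ≤ 1) →
              (∀ {x y} → x < y → 0 < h x → 0 < h y → x ≡ y) → ∀ n → ∑< n h ≤ 1
  ∑<-unique h h≤1 uniq n = s≤s⁻¹ (*-cancelˡ-< (suc n) (∑< n h) 2 (begin-strict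
    suc n * ∑< n h ≤⟨ ∑<-separated h (suc n) h≤1
                        (λ x<y hx hy → contradiction (uniq x<y hx hy) (<⇒≢ x<y)) n ⟩
    n + suc n      <⟨ n<1+n _ ⟩
    suc n + suc n  ≡⟨ double (suc n) ⟩
    suc n * 2      ∎))
    where
    open ≤-Reasoning
    double : ∀ m → m + m ≡ m * 2
    double = solve-∀

  -- Uniqueness leaves at most one nonzero summand. It is only an inequality because z may be
  -- missing from `ys`.
  ∑-delta : ∀ {ys} → Unique ys → ∀ z (f : ℕ → ℕ) → ∑ ys (λ y → 𝟙 (z ≟ y) * f y) ≤ f z
  ∑-delta []                    z f = z≤n
  ∑-delta {y ∷ ys} (y∉ys ∷ uys) z f with z ≟ y
  ... | no  _    = ∑-delta uys z f
  ... | yes refl = begin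
    f z + 0 + ∑ ys (λ y → 𝟙 (z ≟ y) * f y) ≤⟨ +-monoʳ-≤ (f z + 0) (∑-mono ys zeros) ⟩
    f z + 0 + ∑ ys (λ _ → 0)               ≡⟨ cong (f z + 0 +_) (trans (∑-const ys 0) (*-zeroʳ (length ys))) ⟩
    f z + 0 + 0                            ≡⟨ trans (+-identityʳ _) (+-identityʳ _) ⟩
    f z                                    ∎
    where
    open ≤-Reasoning
    zeros : ∀ {x} → x ∈ ys → 𝟙 (z ≟ x) * f x ≤ 0
    zeros {x} p with z ≟ x
    ... | yes z≡x = contradiction z≡x (All.lookup y∉ys p)
    ... | no  _   = z≤n

  -- Cauchy-Schwarz and the size of an image.

  2tr≤t²+r² : ∀ t r → 2 * t * r ≤ t * t + r * r
  2tr≤t²+r² t r with ≤-total t r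
  ... | inj₁ t≤r = subst (λ s → 2 * t * s ≤ t * t + s * s) (m+[n∸m]≡n t≤r)
                     (≤-trans (m≤m+n _ ((r ∸ t) * (r ∸ t))) (≤-reflexive (square t (r ∸ t))))
    where
    square : ∀ t k → 2 * t * (t + k) + k * k ≡ t * t + (t + k) * (t + k)
    square = solve-∀
  ... | inj₂ r≤t = subst (λ s → 2 * s * r ≤ s * s + r * r) (m+[n∸m]≡n r≤t)
                     (≤-trans (m≤m+n _ ((t ∸ r) * (t ∸ r))) (≤-reflexive (square r (t ∸ r))))
    where
    square : ∀ r k → 2 * (r + k) * r + k * k ≡ (r + k) * (r + k) + r * r
    square = solve-∀

  -- Counts ordered pairs, the diagonal included, so it is the second moment of the fibre sizes of
  -- `F`.
  energy : List A → (A → ℕ) → ℕ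
  energy ps F = ∑ ps (λ p → ∑ ps (λ p′ → 𝟙 (F p′ ≟ F p)))

  -- Cauchy–Schwarz, linearised with a free parameter t so that it needs no division.
  image-lower-bound : ∀ (ps : List A) (F : A → ℕ) {ys} → Unique ys → (∀ {p} → p ∈ ps → F p ∈ ys) →
                      ∀ t → 2 * t * length ps ≤ length ys * (t * t) + energy ps F
  image-lower-bound ps F {ys} uys F∈ t = begin
    2 * t * length ps                            ≤⟨ *-monoʳ-≤ (2 * t) covered ⟩
    2 * t * ∑ ys r                               ≡⟨ ∑-*ˡ ys (2 * t) r ⟨
    ∑ ys (λ y → 2 * t * r y)                     ≤⟨ ∑-mono ys (λ {y} _ → 2tr≤t²+r² t (r y)) ⟩
    ∑ ys (λ y → t * t + r y * r y)               ≡⟨ ∑-+ ys _ _ ⟩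
    ∑ ys (λ _ → t * t) + ∑ ys (λ y → r y * r y)  ≤⟨ +-mono-≤ (≤-reflexive (∑-const ys (t * t))) squares ⟩
    length ys * (t * t) + energy ps F            ∎
    where
    open ≤-Reasoning
    r : ℕ → ℕ
    r y = ∑ ps (λ p → 𝟙 (F p ≟ y))
    covered : length ps ≤ ∑ ys r
    covered = begin
      length ps                                  ≡⟨ trans (∑-const ps 1) (*-identityʳ _) ⟨
      ∑ ps (λ _ → 1)                             ≤⟨ ∑-mono ps (λ {p} p∈ →
                                                      ≤-trans (𝟙-yes (F p ≟ F p) refl)
                                                              (term≤∑ (λ y → 𝟙 (F p ≟ y)) (F∈ p∈))) ⟩
      ∑ ps (λ p → ∑ ys (λ y → 𝟙 (F p ≟ y)))      ≡⟨ ∑-swap ps ys _ ⟩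
      ∑ ys r                                     ∎
    squares : ∑ ys (λ y → r y * r y) ≤ energy ps F
    squares = begin
      ∑ ys (λ y → r y * r y)                             ≡⟨ ∑-cong ys (λ y → sym (∑-*ʳ ps _ (r y))) ⟩
      ∑ ys (λ y → ∑ ps (λ p → 𝟙 (F p ≟ y) * r y))        ≡⟨ ∑-swap ps ys _ ⟨
      -- Summing over y first leaves only y = `F p`, and `r (F p)` unfolds to the inner sum of
      -- `energy`.
      ∑ ps (λ p → ∑ ys (λ y → 𝟙 (F p ≟ y) * r y))        ≤⟨ ∑-mono ps (λ {p} _ → ∑-delta uys (F p) r) ⟩
      energy ps F                                        ∎

  -- Takes the free parameter of `image-lower-bound` to be the energy ratio t: from 2tM ≤ Dt² + tM a
  -- factor t cancels.
  few-coincidences⇒large-image : ∀ (ps : List A) (F : A → ℕ) {ys} → Unique ys → (∀ {p} → p ∈ ps → F p ∈ ys) →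
    ∀ t .{{_ : NonZero t}} → energy ps F ≤ t * length ps → length ps ≤ t * length ys
  few-coincidences⇒large-image ps F {ys} uys F∈ t E≤tM = *-cancelˡ-≤ t (+-cancelʳ-≤ (t * M) _ _ (begin
    t * M + t * M                  ≡⟨ double t M ⟩
    2 * t * M                      ≤⟨ image-lower-bound ps F uys F∈ t ⟩
    D * (t * t) + energy ps F      ≤⟨ +-monoʳ-≤ (D * (t * t)) E≤tM ⟩
    D * (t * t) + t * M            ≡⟨ cong (_+ t * M) (regroup D t) ⟩
    t * (t * D) + t * M            ∎))
    where
    open ≤-Reasoning
    M = length ps
    D = length ys
    double : ∀ t M → t * M + t * M ≡ 2 * t * M
    double = solve-∀
    regroup : ∀ D t → D * (t * t) ≡ t * (t * D)
    regroup = solve-∀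

  -- Counting residue classes.

  same-residue-separated : ∀ g .{{_ : NonZero g}} {x y} → x < y → x % g ≡ y % g → x + g ≤ y
  same-residue-separated g {x} {y} x<y eq = begin
    x + g                         ≡⟨ cong (_+ g) (m≡m%n+[m/n]*n x g) ⟩
    x % g + x / g * g + g         ≡⟨ rearrange (x % g) (x / g) g ⟩
    x % g + suc (x / g) * g       ≤⟨ +-mono-≤ (≤-reflexive eq) (*-monoˡ-≤ g x/g<y/g) ⟩
    y % g + y / g * g             ≡⟨ m≡m%n+[m/n]*n y g ⟨
    y                             ∎
    where
    open ≤-Reasoning
    rearrange : ∀ r q g → r + q * g + g ≡ r + suc q * g
    rearrange = solve-∀
    x/g<y/g : x / g < y / g
    x/g<y/g = ≰⇒> λ y/g≤x/g → <⇒≱ x<y (begin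
      y                   ≡⟨ m≡m%n+[m/n]*n y g ⟩
      y % g + y / g * g   ≤⟨ +-mono-≤ (≤-reflexive (sym eq)) (*-monoˡ-≤ g y/g≤x/g) ⟩
      x % g + x / g * g   ≡⟨ m≡m%n+[m/n]*n x g ⟨
      x                   ∎)

  -- Points of one class are at least g apart. The offset `a` will be the start of a block, a carry,
  -- or the least length N.
  residue-count : ∀ n g .{{_ : NonZero g}} a r → g * ∑< n (λ x → 𝟙 ((a + x) % g ≟ r)) ≤ n + g
  residue-count n g a r = ∑<-separated _ g (λ x → 𝟙≤1 ((a + x) % g ≟ r)) separated n
    where
    separated : ∀ {x y} → x < y → 0 < 𝟙 ((a + x) % g ≟ r) → 0 < 𝟙 ((a + y) % g ≟ r) → x + g ≤ y
    separated {x} {y} x<y hx hy = +-cancelˡ-≤ a (x + g) y (subst (_≤ a + y) (+-assoc a x g)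
      (same-residue-separated g (+-monoʳ-< a x<y) (trans (𝟙-true _ hx) (sym (𝟙-true _ hy)))))

  residue-count-/ : ∀ n g .{{_ : NonZero g}} a r → ∑< n (λ x → 𝟙 ((a + x) % g ≟ r)) ≤ n / g + 1
  residue-count-/ n g a r = begin
    S                ≡⟨ m*n/n≡m S g ⟨
    S * g / g        ≡⟨ cong (_/ g) (*-comm S g) ⟩
    g * S / g        ≤⟨ /-monoˡ-≤ g (residue-count n g a r) ⟩
    (n + g) / g      ≡⟨ +-distrib-/-∣ʳ n {g} (divides 1 (sym (+-identityʳ g))) ⟩
    n / g + g / g    ≡⟨ cong (n / g +_) (n/n≡1 g) ⟩
    n / g + 1        ∎
    where
    open ≤-Reasoning
    S = ∑< n (λ x → 𝟙 ((a + x) % g ≟ r))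

  -- Coincidences between windows of two fixed lengths.

  -- φ d u = (u + d)² − u².
  φ : ℕ → ℕ → ℕ
  φ d u = d * (2 * u + d)

  φ-shift : ∀ d u w → φ d (u + w) ≡ φ d u + d * (2 * w)
  φ-shift = expand
    where
    expand : ∀ d u w → d * (2 * (u + w) + d) ≡ d * (2 * u + d) + d * (2 * w)
    expand = solve-∀

  φ-mono-≤ : ∀ d {u v} → u ≤ v → φ d u ≤ φ d v
  φ-mono-≤ d u≤v = *-monoʳ-≤ d (+-monoˡ-≤ d (*-monoʳ-≤ 2 u≤v))

  φ-mono-< : ∀ d .{{_ : NonZero d}} {u v} → u < v → φ d u < φ d v
  φ-mono-< d u<v = *-monoʳ-< d (+-monoˡ-< d (*-monoʳ-< 2 u<v))

  ∣φ : ∀ x g u → g ∣ φ (x * g) u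
  ∣φ x g u = n∣m*n*o x (2 * u + x * g)

  module _ (x y g c c′ : ℕ) .{{_ : NonZero g}} .{{_ : NonZero (y * g)}} (coprime : Coprime x y) where

    -- The lengths are d = xg and d′ = yg with g their gcd; `c` and `c′` stand for the corrections
    -- ⌊d/b⌋ + e and ⌊d′/b⌋ + e′.
    Collision : ℕ → ℕ → Set
    Collision u u′ = φ (y * g) u′ + c′ ≡ φ (x * g) u + c

    collision-unique : ∀ {u u′ v′} → u′ < v′ → Collision u u′ → Collision u v′ → u′ ≡ v′
    collision-unique u′<v′ p q =
      contradiction (trans p (sym q)) (<⇒≢ (+-monoˡ-< c′ (φ-mono-< (y * g) u′<v′)))

    -- Subtracting the two collisions gives yg · 2w′ = xg · 2w for the differences w = v - u and w′
    -- = v′ - u′. Cancelling 2g leaves yw′ = xw, and coprimality forces y to divide the positive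
    -- number w.
    collision-separated : ∀ {u u′ v v′} → u < v → Collision u u′ → Collision v v′ → u + y ≤ v
    collision-separated {u} {u′} {v} {v′} u<v p q =
      ≤-trans (+-monoʳ-≤ u (∣⇒≤ {{>-nonZero (m<n⇒0<n∸m u<v)}}
                 (coprime-divisor (Coprimality.sym coprime) (divides w′ (trans (sym yw′≡xw) (*-comm y w′))))))
              (≤-reflexive (m+[n∸m]≡n (<⇒≤ u<v)))
      where
      w = v ∸ u
      w′ = v′ ∸ u′
      -- Monotonicity of φ in both lengths; without it the truncated difference `w′` would not be
      -- the true one.
      u′≤v′ : u′ ≤ v′
      u′≤v′ = ≮⇒≥ λ v′<u′ → <⇒≱ (+-monoˡ-< c′ (φ-mono-< (y * g) v′<u′))
        (subst₂ _≤_ (sym p) (sym q) (+-monoˡ-≤ c (φ-mono-≤ (x * g) (<⇒≤ u<v))))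
      shifted : ∀ d u v c → u ≤ v → φ d v + c ≡ φ d u + c + d * (2 * (v ∸ u))
      shifted d u v c u≤v = trans (cong (λ s → φ d s + c) (sym (m+[n∸m]≡n u≤v)))
        (trans (cong (_+ c) (φ-shift d u (v ∸ u))) (swap (φ d u) (d * (2 * (v ∸ u))) c))
        where
        swap : ∀ p q r → p + q + r ≡ p + r + q
        swap = solve-∀
      products : (y * g) * (2 * w′) ≡ (x * g) * (2 * w)
      products = +-cancelˡ-≡ (φ (x * g) u + c) _ _ (begin
        φ (x * g) u + c + (y * g) * (2 * w′)    ≡⟨ cong (_+ (y * g) * (2 * w′)) p ⟨
        φ (y * g) u′ + c′ + (y * g) * (2 * w′)  ≡⟨ shifted (y * g) u′ v′ c′ u′≤v′ ⟨
        φ (y * g) v′ + c′                       ≡⟨ q ⟩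
        φ (x * g) v + c                         ≡⟨ shifted (x * g) u v c (<⇒≤ u<v) ⟩
        φ (x * g) u + c + (x * g) * (2 * w)     ∎)
        where open ≡-Reasoning
      yw′≡xw : y * w′ ≡ x * w
      yw′≡xw = *-cancelˡ-≡ _ _ (g * 2) {{m*n≢0 g 2}} (trans (factor y g w′) (trans products (sym (factor x g w))))
        where
        factor : ∀ y g w → g * 2 * (y * w) ≡ (y * g) * (2 * w)
        factor = solve-∀

    -- Both values of φ are multiples of g, so only the corrections survive modulo g.
    collision-residue : ∀ {u u′} → Collision u u′ → c′ % g ≡ c % g
    collision-residue {u} {u′} p = trans (sym (%-remove-+ˡ c′ (∣φ y g u′)))
      (trans (cong (_% g) p) (%-remove-+ˡ c (∣φ x g u)))

    collisionsAt : ℕ → ℕ → ℕ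
    collisionsAt N u = ∑< N (λ u′ → 𝟙 (φ (y * g) u′ + c′ ≟ φ (x * g) u + c))

    -- Each u meets at most one u′, and the u that occur are y apart, so y times their number is at
    -- most N + y ≤ y(g + 1); then g + 1 ≤ 2g. A single collision already yields the congruence of
    -- the corrections. The two divisibility indicators are recorded so that g may later range over
    -- all moduli.
    collision-count : ∀ N → N ≤ y * g → ∑< N (collisionsAt N)
      ≤ 2 * g * (𝟙 (x * g % g ≟ 0) * (𝟙 (y * g % g ≟ 0) * 𝟙 (c′ % g ≟ c % g)))
    collision-count N N≤yg with ∑< N (collisionsAt N) in eq
    ... | zero  = z≤n
    ... | suc s = begin
      suc s                ≤⟨ s≤g ⟩
      suc g                ≤⟨ +-monoˡ-≤ g (>-nonZero⁻¹ g) ⟩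
      g + g                ≡⟨ double g ⟩
      2 * g * 1            ≤⟨ *-monoʳ-≤ (2 * g) ones ⟩
      _                    ∎
      where
      open ≤-Reasoning
      h : ℕ → ℕ
      h = collisionsAt N
      double : ∀ g → g + g ≡ 2 * g * 1
      double = solve-∀
      witness : ∀ u → 0 < h u → ∃ λ u′ → Collision u u′
      witness u hu with u′ , p ← ∑-positive (downFrom N) hu =
        u′ , 𝟙-true (φ (y * g) u′ + c′ ≟ φ (x * g) u + c) p
      h≤1 : ∀ u → h u ≤ 1
      h≤1 u = ∑<-unique _ (λ u′ → 𝟙≤1 (φ (y * g) u′ + c′ ≟ φ (x * g) u + c))
        (λ {u′} {v′} lt p q → collision-unique {u} lt
          (𝟙-true (φ (y * g) u′ + c′ ≟ φ (x * g) u + c) p)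
          (𝟙-true (φ (y * g) v′ + c′ ≟ φ (x * g) u + c) q)) N
      s≤g : suc s ≤ suc g
      s≤g = *-cancelˡ-≤ y {{m*n≢0⇒m≢0 y}} (begin
        y * suc s     ≡⟨ cong (y *_) eq ⟨
        y * ∑< N h    ≤⟨ ∑<-separated h y h≤1 (λ {u} {v} lt p q →
                           collision-separated {u} {proj₁ (witness u p)} {v} {proj₁ (witness v q)}
                             lt (proj₂ (witness u p)) (proj₂ (witness v q))) N ⟩
        N + y         ≤⟨ +-monoˡ-≤ y N≤yg ⟩
        y * g + y     ≡⟨ trans (+-comm (y * g) y) (sym (*-suc y g)) ⟩
        y * suc g     ∎)
      ones : 1 ≤ 𝟙 (x * g % g ≟ 0) * (𝟙 (y * g % g ≟ 0) * 𝟙 (c′ % g ≟ c % g))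
      ones with u , p ← ∑-positive (downFrom N) (subst (0 <_) (sym eq) z<s) =
        *-mono-≤ (𝟙-yes (x * g % g ≟ 0) (m*n%n≡0 x g)) (*-mono-≤ (𝟙-yes (y * g % g ≟ 0) (m*n%n≡0 y g))
          (𝟙-yes (c′ % g ≟ c % g) (collision-residue {u} {proj₁ (witness u p)} (proj₂ (witness u p)))))

  collision-count-gcd : ∀ N d d′ c c′ → 0 < N → N ≤ d → N ≤ d′ → ∃ λ g → g < d ×
    (∑< N (λ u → ∑< N (λ u′ → 𝟙 (φ d′ u′ + c′ ≟ φ d u + c)))
      ≤ 2 * suc g * (𝟙 (d % suc g ≟ 0) * (𝟙 (d′ % suc g ≟ 0) * 𝟙 (c′ % suc g ≟ c % suc g))))
  -- The gcd is abstracted with its equation so that it can be matched as a successor; zero is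
  -- excluded by d > 0.
  collision-count-gcd N d d′ c c′ 0<N N≤d N≤d′ = by-gcd (gcd d d′) refl
    where
    0<d : 0 < d
    0<d = ≤-trans 0<N N≤d
    Bound : ℕ → ℕ → ℕ → Set
    Bound g d d′ = ∑< N (λ u → ∑< N (λ u′ → 𝟙 (φ d′ u′ + c′ ≟ φ d u + c)))
      ≤ 2 * suc g * (𝟙 (d % suc g ≟ 0) * (𝟙 (d′ % suc g ≟ 0) * 𝟙 (c′ % suc g ≟ c % suc g)))
    by-gcd : ∀ g → gcd d d′ ≡ g → ∃ λ g → g < d × Bound g d d′
    by-gcd zero    eq = contradiction eq (gcd[m,n]≢0 d d′ (inj₁ (≢-sym (<⇒≢ 0<d))))
    by-gcd (suc g) eq = g , ∣⇒≤ {{>-nonZero 0<d}} g∣d ,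
      subst₂ (Bound g) xg≡d yg≡d′
        (collision-count (d / suc g) (d′ / suc g) (suc g) c c′
          {{_}} {{subst NonZero (sym yg≡d′) (>-nonZero (≤-trans 0<N N≤d′))}} coprime N
          (≤-trans N≤d′ (≤-reflexive (sym yg≡d′))))
      where
      g∣d : suc g ∣ d
      g∣d = subst (_∣ d) eq (gcd[m,n]∣m d d′)
      xg≡d : d / suc g * suc g ≡ d
      xg≡d = m/n*n≡m g∣d
      yg≡d′ : d′ / suc g * suc g ≡ d′
      yg≡d′ = m/n*n≡m (subst (_∣ d′) eq (gcd[m,n]∣n d d′))
      instance
        gcd≢0 : NonZero (gcd d d′)
        gcd≢0 = subst NonZero (sym eq) _
      coprime : Coprime (d / suc g) (d′ / suc g)
      coprime = subst₂ Coprime (/-congʳ eq) (/-congʳ eq) (coprime-/gcd d d′)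

  -- Lengths with prescribed residues, and the sum over moduli.

  -- The modulus is suc g, here and in every sum over g below.
  H : ℕ → ℕ → ℕ → ℕ
  H Q b g = (Q / suc g + 1) * (b / suc g + 1)

  -- Writing d = qb + ρ makes ⌊d/b⌋ = q constant on a block. The conditions then separate: for given
  -- q, one class for ρ, and one class for q itself.
  block-residue-count : ∀ Q b .{{_ : NonZero b}} M e c g → M ≤ Q * b →
    ∑< M (λ d → 𝟙 (d % suc g ≟ 0) * 𝟙 ((d / b + e) % suc g ≟ c % suc g)) ≤ H Q b g
  block-residue-count Q b M e c g M≤Qb = begin
    ∑< M f                                                          ≤⟨ ∑<-monoˡ f M≤Qb ⟩
    ∑< (Q * b) f                                                    ≡⟨ ∑<-blocks Q b f ⟩
    ∑< Q (λ q → ∑< b (λ ρ → f (q * b + ρ)))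
      ≤⟨ ∑<-mono Q (λ {q} _ → ∑<-mono b (λ {ρ} ρ<b → in-block q ρ ρ<b)) ⟩
    ∑< Q (λ q → ∑< b (λ ρ → 𝟙 ((q * b + ρ) % suc g ≟ 0) * k q))
      ≡⟨ ∑-cong (downFrom Q) (λ q → ∑-*ʳ (downFrom b) _ (k q)) ⟩
    ∑< Q (λ q → ∑< b (λ ρ → 𝟙 ((q * b + ρ) % suc g ≟ 0)) * k q)
      ≤⟨ ∑<-mono Q (λ {q} _ → *-monoˡ-≤ (k q) (residue-count-/ b (suc g) (q * b) 0)) ⟩
    ∑< Q (λ q → (b / suc g + 1) * k q)                              ≡⟨ ∑-*ˡ (downFrom Q) (b / suc g + 1) k ⟩
    (b / suc g + 1) * ∑< Q k
      ≤⟨ *-monoʳ-≤ (b / suc g + 1) (residue-count-/ Q (suc g) e (c % suc g)) ⟩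
    (b / suc g + 1) * (Q / suc g + 1)                               ≡⟨ *-comm (b / suc g + 1) _ ⟩
    H Q b g                                                         ∎
    where
    open ≤-Reasoning
    f k : ℕ → ℕ
    f d = 𝟙 (d % suc g ≟ 0) * 𝟙 ((d / b + e) % suc g ≟ c % suc g)
    k q = 𝟙 ((e + q) % suc g ≟ c % suc g)
    in-block : ∀ q ρ → ρ < b → f (q * b + ρ) ≤ 𝟙 ((q * b + ρ) % suc g ≟ 0) * k q
    in-block q ρ ρ<b = ≤-reflexive (cong (λ s → 𝟙 ((q * b + ρ) % suc g ≟ 0) * 𝟙 (s % suc g ≟ c % suc g))
      (trans (cong (_+ e) quotient) (+-comm q e)))
      where
      quotient : (q * b + ρ) / b ≡ q
      quotient = trans (+-distrib-/-∣ˡ ρ (divides q refl))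
        (trans (cong₂ _+_ (m*n/n≡m q b) (m<n⇒m/n≡0 ρ<b)) (+-identityʳ q))

  _/2^_ : ℕ → ℕ → ℕ
  m /2^ k = _/_ m (2 ^ k) {{m^n≢0 2 k}}

  -- Doubling the range from P = 2ᵏ adds P moduli exceeding P, which contribute at most Qr + Q + b +
  -- P with r = ⌊b/P⌋. The extra summand on the left absorbs the geometric series of the Qr: for s =
  -- ⌊b/2P⌋ one has 2s ≤ r, so Qr + 2Qs ≤ 2Qr. What remains per doubling is Q + b, the logarithmic
  -- term.
  ∑H-dyadic : ∀ Q b k → ∑< (2 ^ k) (H Q b) + 2 * (Q * (b /2^ k))
                ≤ (Q + 1) * (b + 1) + 2 * (Q * b) + k * (Q + b) + 2 ^ k
  ∑H-dyadic Q b zero = begin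
    H Q b 0 + 0 + 2 * (Q * (b / 1))
      ≡⟨ cong₂ (λ s t → (s + 1) * (t + 1) + 0 + 2 * (Q * t)) (n/1≡n Q) (n/1≡n b) ⟩
    (Q + 1) * (b + 1) + 0 + 2 * (Q * b)                            ≤⟨ m≤m+n _ 1 ⟩
    (Q + 1) * (b + 1) + 0 + 2 * (Q * b) + 1
      ≡⟨ rearrange ((Q + 1) * (b + 1)) (2 * (Q * b)) ⟩
    (Q + 1) * (b + 1) + 2 * (Q * b) + 0 * (Q + b) + 1              ∎
    where
    open ≤-Reasoning
    rearrange : ∀ p q → p + 0 + q + 1 ≡ p + q + 0 + 1
    rearrange = solve-∀
  ∑H-dyadic Q b (suc k) = begin
    ∑< (2 ^ suc k) (H Q b) + 2 * (Q * s)
      ≡⟨ cong (λ m → ∑< m (H Q b) + 2 * (Q * s)) (cong (P +_) (+-identityʳ P)) ⟩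
    ∑< (P + P) (H Q b) + 2 * (Q * s)
      ≡⟨ cong (_+ 2 * (Q * s)) (∑<-split P P (H Q b)) ⟩
    S + ∑< P (λ x → H Q b (P + x)) + 2 * (Q * s)
      ≤⟨ +-monoˡ-≤ (2 * (Q * s)) (+-monoʳ-≤ S upper-half) ⟩
    S + (Q * r + Q + b + P) + 2 * (Q * s)                          ≡⟨ rearrange₁ S Q b P r s ⟩
    S + (Q * r + Q * (s * 2)) + (Q + b + P)
      ≤⟨ +-monoˡ-≤ (Q + b + P) (+-monoʳ-≤ S (+-monoʳ-≤ (Q * r) (*-monoʳ-≤ Q s*2≤r))) ⟩
    S + (Q * r + Q * r) + (Q + b + P)
      ≡⟨ cong (λ t → S + t + (Q + b + P)) (double (Q * r)) ⟩
    S + 2 * (Q * r) + (Q + b + P)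
      ≤⟨ +-monoˡ-≤ (Q + b + P) (∑H-dyadic Q b k) ⟩
    (Q + 1) * (b + 1) + 2 * (Q * b) + k * (Q + b) + P + (Q + b + P)
      ≡⟨ rearrange₂ ((Q + 1) * (b + 1) + 2 * (Q * b)) k (Q + b) P ⟩
    (Q + 1) * (b + 1) + 2 * (Q * b) + suc k * (Q + b) + 2 ^ suc k  ∎
    where
    open ≤-Reasoning
    P = 2 ^ k
    S = ∑< P (H Q b)
    r = b / P
    instance
      P≢0 : NonZero P
      P≢0 = m^n≢0 2 k
    s = b /2^ suc k
    double : ∀ t → t + t ≡ 2 * t
    double = solve-∀
    rearrange₁ : ∀ S Q b P r s → S + (Q * r + Q + b + P) + 2 * (Q * s) ≡ S + (Q * r + Q * (s * 2)) + (Q + b + P)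
    rearrange₁ = solve-∀
    rearrange₂ : ∀ p k q P → p + k * q + P + (q + P) ≡ p + suc k * q + 2 * P
    rearrange₂ = solve-∀
    s*2≤r : s * 2 ≤ r
    s*2≤r = ≤-trans (≤-reflexive (cong (_* 2) (trans (/-congʳ {{m^n≢0 2 (suc k)}} {{m*n≢0 P 2}} (*-comm 2 P)) (sym (m/n/o≡m/[n*o] b P 2 {{_}} {{_}} {{m*n≢0 P 2}})))))
              (m/n*n≤m (b / P) 2)
    expand : ∀ P p r → P * ((p + 1) * (r + 1)) ≡ P * p * r + P * p + P * r + P
    expand = solve-∀
    P*[m/P]≤m : ∀ m → P * (m / P) ≤ m
    P*[m/P]≤m m = ≤-trans (≤-reflexive (*-comm P (m / P))) (m/n*n≤m m P)
    upper-half : ∑< P (λ x → H Q b (P + x)) ≤ Q * r + Q + b + P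
    upper-half = begin
      ∑< P (λ x → H Q b (P + x))                ≤⟨ ∑<-mono P (λ {x} _ →
           *-mono-≤ (+-monoˡ-≤ 1 (/-monoʳ-≤ Q {o = P} (m≤n⇒m≤1+n (m≤m+n P x)))) (+-monoˡ-≤ 1 (/-monoʳ-≤ b {o = P} (m≤n⇒m≤1+n (m≤m+n P x))))) ⟩
      ∑< P (λ _ → (Q / P + 1) * (r + 1))
        ≡⟨ trans (∑-const (downFrom P) _) (cong (_* ((Q / P + 1) * (r + 1))) (length-downFrom P)) ⟩
      P * ((Q / P + 1) * (r + 1))               ≡⟨ expand P (Q / P) r ⟩
      P * (Q / P) * r + P * (Q / P) + P * r + P
        ≤⟨ +-monoˡ-≤ P (+-mono-≤ (+-mono-≤ (*-monoˡ-≤ r (P*[m/P]≤m Q)) (P*[m/P]≤m Q)) (P*[m/P]≤m b)) ⟩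
      Q * r + Q + b + P                         ∎

  -- The energy of the grid of windows.

  -- The point (i , u) stands for the window u+1, …, u+d of length d = N + i.
  grid : ℕ → List (ℕ × ℕ)
  grid N = cartesianProduct (downFrom N) (downFrom N)

  gridValue : ℕ → (ℕ → ℕ → ℕ) → ℕ × ℕ → ℕ
  gridValue N G (i , u) = G (N + i) u

  module _ (b N T Q : ℕ) .{{_ : NonZero b}} (0<N : 0 < N) (2N≤T : N + N ≤ T) (2N≤Qb : N + N ≤ Q * b)
           (G : ℕ → ℕ → ℕ) (G-form : ∀ d u → ∃ λ e → e < 2 × G d u ≡ φ d u + (d / b + e)) where

    private
      F : ℕ × ℕ → ℕ
      F = gridValue N G

    carries : List (ℕ × ℕ)
    carries = cartesianProduct (downFrom 2) (downFrom 2)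

    -- The bound of `collision-count-gcd`, with the modulus as a free variable in place of the gcd.
    weight : ℕ → ℕ → ℕ × ℕ → ℕ → ℕ
    weight d d′ (e , e′) g =
      2 * suc g * (𝟙 (d % suc g ≟ 0) * (𝟙 (d′ % suc g ≟ 0) * 𝟙 ((d′ / b + e′) % suc g ≟ (d / b + e) % suc g)))

    -- The carries depend on u and u′, so each coincidence is charged to its own pair of carries.
    -- For a fixed pair the gcd bound is one term of the sum over all moduli up to T; after this
    -- enlargement the modulus no longer depends on the lengths.
    pair-bound : ∀ {i i′} → i < N → i′ < N →
      ∑< N (λ u → ∑< N (λ u′ → 𝟙 (F (i′ , u′) ≟ F (i , u))))
        ≤ ∑ carries (λ ε → ∑< T (weight (N + i) (N + i′) ε))
    pair-bound {i} {i′} i<N i′<N = begin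
      ∑< N (λ u → ∑< N (λ u′ → 𝟙 (F (i′ , u′) ≟ F (i , u))))
        ≤⟨ ∑<-mono N (λ {u} _ → ∑<-mono N (λ {u′} _ → 𝟙-mono (F (i′ , u′) ≟ F (i , u)) (split u u′))) ⟩
      ∑< N (λ u → ∑< N (λ u′ → ∑ carries (λ ε → hit ε u u′)))
        ≡⟨ ∑-cong (downFrom N) (λ u → ∑-swap (downFrom N) carries (λ u′ ε → hit ε u u′)) ⟩
      ∑< N (λ u → ∑ carries (λ ε → ∑< N (λ u′ → hit ε u u′)))
        ≡⟨ ∑-swap (downFrom N) carries (λ u ε → ∑< N (λ u′ → hit ε u u′)) ⟩
      ∑ carries (λ ε → ∑< N (λ u → ∑< N (λ u′ → hit ε u u′)))
        ≤⟨ ∑-mono carries (λ {ε} _ → by-gcd ε) ⟩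
      ∑ carries (λ ε → ∑< T (weight d d′ ε)) ∎
      where
      open ≤-Reasoning
      d = N + i
      d′ = N + i′
      hit : ℕ × ℕ → ℕ → ℕ → ℕ
      hit (e , e′) u u′ = 𝟙 (φ d′ u′ + (d′ / b + e′) ≟ φ d u + (d / b + e))
      split : ∀ u u′ → F (i′ , u′) ≡ F (i , u) → 1 ≤ ∑ carries (λ ε → hit ε u u′)
      split u u′ eq with e , e<2 , p ← G-form d u | e′ , e′<2 , p′ ← G-form d′ u′ =
        ≤-trans (𝟙-yes (φ d′ u′ + (d′ / b + e′) ≟ φ d u + (d / b + e)) (trans (sym p′) (trans eq p)))
                (term≤∑ (λ ε → hit ε u u′) (∈-cartesianProduct⁺ (∈-downFrom⁺ e<2) (∈-downFrom⁺ e′<2)))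
      by-gcd : ∀ ε → ∑< N (λ u → ∑< N (λ u′ → hit ε u u′)) ≤ ∑< T (weight d d′ ε)
      by-gcd (e , e′) with g , g<d , bound ← collision-count-gcd N d d′ (d / b + e) (d′ / b + e′)
                                               0<N (m≤m+n N i) (m≤m+n N i′) =
        ≤-trans bound (term≤∑ (weight d d′ (e , e′))
          (∈-downFrom⁺ (<-≤-trans g<d (≤-trans (<⇒≤ (+-monoʳ-< N i<N)) 2N≤T))))

    -- Once the modulus is summed outside, `block-residue-count` handles d′; the factor 4 is the
    -- number of pairs of carries.
    row-bound : ∀ i → ∑< N (λ i′ → ∑ carries (λ ε → ∑< T (weight (N + i) (N + i′) ε)))
                        ≤ 4 * ∑< T (λ g → 2 * suc g * (𝟙 ((N + i) % suc g ≟ 0) * H Q b g))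
    row-bound i = begin
      ∑< N (λ i′ → ∑ carries (λ ε → ∑< T (λ g → weight d (N + i′) ε g)))
        ≡⟨ ∑-swap (downFrom N) carries (λ i′ ε → ∑< T (weight d (N + i′) ε)) ⟩
      ∑ carries (λ ε → ∑< N (λ i′ → ∑< T (λ g → weight d (N + i′) ε g)))
        ≡⟨ ∑-cong carries (λ ε → ∑-swap (downFrom N) (downFrom T) (λ i′ g → weight d (N + i′) ε g)) ⟩
      ∑ carries (λ ε → ∑< T (λ g → ∑< N (λ i′ → weight d (N + i′) ε g)))
        ≤⟨ ∑-mono carries (λ {ε} _ → ∑<-mono T (λ {g} _ → entry ε g)) ⟩
      ∑ carries (λ _ → ∑< T (λ g → 2 * suc g * (𝟙 (d % suc g ≟ 0) * H Q b g)))
        ≡⟨ ∑-const carries (∑< T (λ g → 2 * suc g * (𝟙 (d % suc g ≟ 0) * H Q b g))) ⟩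
      4 * ∑< T (λ g → 2 * suc g * (𝟙 (d % suc g ≟ 0) * H Q b g)) ∎
      where
      open ≤-Reasoning
      d = N + i
      entry : ∀ ε g → ∑< N (λ i′ → weight d (N + i′) ε g) ≤ 2 * suc g * (𝟙 (d % suc g ≟ 0) * H Q b g)
      entry (e , e′) g = begin
        ∑< N (λ i′ → 2 * suc g * (δ * f (N + i′)))     ≡⟨ ∑-*ˡ (downFrom N) (2 * suc g) _ ⟩
        2 * suc g * ∑< N (λ i′ → δ * f (N + i′))       ≡⟨ cong (2 * suc g *_) (∑-*ˡ (downFrom N) δ _) ⟩
        2 * suc g * (δ * ∑< N (λ i′ → f (N + i′)))     ≤⟨ *-monoʳ-≤ (2 * suc g) (*-monoʳ-≤ δ extend) ⟩
        2 * suc g * (δ * ∑< (N + N) f)                 ≤⟨ *-monoʳ-≤ (2 * suc g) (*-monoʳ-≤ δ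
                                                            (block-residue-count Q b (N + N) e′ (d / b + e) g 2N≤Qb)) ⟩
        2 * suc g * (δ * H Q b g)                      ∎
        where
        δ = 𝟙 (d % suc g ≟ 0)
        f : ℕ → ℕ
        f d′ = 𝟙 (d′ % suc g ≟ 0) * 𝟙 ((d′ / b + e′) % suc g ≟ (d / b + e) % suc g)
        -- The blocks start at 0, so the range [N, 2N) is enlarged to [0, 2N).
        extend : ∑< N (λ i′ → f (N + i′)) ≤ ∑< (N + N) f
        extend = ≤-trans (m≤n+m _ _) (≤-reflexive (sym (∑<-split N N f)))

    energy-bound : energy (grid N) F ≤ 4 * (2 * (N + T) * ∑< T (H Q b))
    energy-bound = begin
      energy (grid N) F
        ≡⟨ ∑-cartesianProduct (downFrom N) (downFrom N) _ ⟩
      ∑< N (λ i → ∑< N (λ u → ∑ (grid N) (λ p′ → 𝟙 (F p′ ≟ F (i , u)))))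
        ≡⟨ ∑-cong (downFrom N) (λ i → ∑-cong (downFrom N) (λ u → ∑-cartesianProduct (downFrom N) (downFrom N) _)) ⟩
      ∑< N (λ i → ∑< N (λ u → ∑< N (λ i′ → ∑< N (λ u′ → 𝟙 (F (i′ , u′) ≟ F (i , u))))))
        ≡⟨ ∑-cong (downFrom N) (λ i → ∑-swap (downFrom N) (downFrom N) (λ u i′ → ∑< N (λ u′ → 𝟙 (F (i′ , u′) ≟ F (i , u))))) ⟩
      ∑< N (λ i → ∑< N (λ i′ → ∑< N (λ u → ∑< N (λ u′ → 𝟙 (F (i′ , u′) ≟ F (i , u))))))
        ≤⟨ ∑<-mono N (λ i<N → ≤-trans (∑<-mono N (λ i′<N → pair-bound i<N i′<N)) (row-bound _)) ⟩
      ∑< N (λ i → 4 * ∑< T (λ g → 2 * suc g * (𝟙 ((N + i) % suc g ≟ 0) * H Q b g)))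
        ≡⟨ ∑-*ˡ (downFrom N) 4 _ ⟩
      4 * ∑< N (λ i → ∑< T (λ g → 2 * suc g * (𝟙 ((N + i) % suc g ≟ 0) * H Q b g)))
        ≡⟨ cong (4 *_) (∑-swap (downFrom N) (downFrom T) (λ i g → 2 * suc g * (𝟙 ((N + i) % suc g ≟ 0) * H Q b g))) ⟩
      4 * ∑< T (λ g → ∑< N (λ i → 2 * suc g * (𝟙 ((N + i) % suc g ≟ 0) * H Q b g)))
        ≤⟨ *-monoʳ-≤ 4 (∑<-mono T column) ⟩
      4 * ∑< T (λ g → 2 * (N + T) * H Q b g)
        ≡⟨ cong (4 *_) (∑-*ˡ (downFrom T) (2 * (N + T)) (H Q b)) ⟩
      4 * (2 * (N + T) * ∑< T (H Q b)) ∎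
      where
      open ≤-Reasoning
      regroup : ∀ s D h → 2 * s * (D * h) ≡ 2 * (s * D) * h
      regroup = solve-∀
      -- The saving from divisibility of d: the modulus times the number of its multiples in [N, 2N)
      -- is at most N + T, which absorbs the factor `suc g`.
      column : ∀ {g} → g < T → ∑< N (λ i → 2 * suc g * (𝟙 ((N + i) % suc g ≟ 0) * H Q b g)) ≤ 2 * (N + T) * H Q b g
      column {g} g<T = begin
        ∑< N (λ i → 2 * suc g * (𝟙 ((N + i) % suc g ≟ 0) * H Q b g))  ≡⟨ ∑-*ˡ (downFrom N) (2 * suc g) _ ⟩
        2 * suc g * ∑< N (λ i → 𝟙 ((N + i) % suc g ≟ 0) * H Q b g)
          ≡⟨ cong (2 * suc g *_) (∑-*ʳ (downFrom N) _ (H Q b g)) ⟩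
        2 * suc g * (D * H Q b g)                                     ≡⟨ regroup (suc g) D (H Q b g) ⟩
        2 * (suc g * D) * H Q b g                                     ≤⟨ *-monoˡ-≤ (H Q b g) (*-monoʳ-≤ 2
                                                                           (≤-trans (residue-count N (suc g) N 0) (+-monoʳ-≤ N g<T))) ⟩
        2 * (N + T) * H Q b g                                         ∎
        where
        D = ∑< N (λ i → 𝟙 ((N + i) % suc g ≟ 0))

  -- Window sums of the sequence.

  -- The extra 1 at multiples of b is exactly the increment of ⌊i/b⌋. The term `i / b` stands on the
  -- left to avoid subtraction.
  seqA-step : ∀ b .{{_ : NonZero b}} i → seqA b (suc i) + i / b ≡ 2 * i + 1 + suc i / b
  seqA-step b i with b ∣? suc i
  ... | yes b∣1+i = begin
    2 * suc i + i / b           ≡⟨ rearrange i (i / b) ⟩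
    2 * i + 1 + (i / b + 1)     ≡⟨ cong (2 * i + 1 +_) quotient ⟨
    2 * i + 1 + suc i / b       ∎
    where
    open ≡-Reasoning
    rearrange : ∀ i q → 2 * suc i + q ≡ 2 * i + 1 + (q + 1)
    rearrange = solve-∀
    i%b : i % b ≡ b ∸ 1
    i%b = %-pred-≡0 (n∣m⇒m%n≡0 (suc i) b b∣1+i)
    quotient : suc i / b ≡ i / b + 1
    quotient = begin
      suc i / b                        ≡⟨ cong (λ j → suc j / b) (m≡m%n+[m/n]*n i b) ⟩
      suc (i % b + i / b * b) / b      ≡⟨ cong (λ r → (suc r + i / b * b) / b) i%b ⟩
      (suc (b ∸ 1) + i / b * b) / b    ≡⟨ cong (λ s → (s + i / b * b) / b) (suc-pred b) ⟩
      suc (i / b) * b / b              ≡⟨ m*n/n≡m (suc (i / b)) b ⟩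
      suc (i / b)                      ≡⟨ +-comm 1 (i / b) ⟩
      i / b + 1                        ∎
  ... | no b∤1+i = begin
    2 * suc i ∸ 1 + i / b       ≡⟨ cong (_+ i / b) (predecessor i) ⟩
    2 * i + 1 + i / b           ≡⟨ cong (2 * i + 1 +_) quotient ⟨
    2 * i + 1 + suc i / b       ∎
    where
    open ≡-Reasoning
    -- The left side is the form to which `2 * suc i ∸ 1` reduces.
    predecessor : ∀ i → i + suc (i + 0) ≡ 2 * i + 1
    predecessor = solve-∀
    1+r<b : suc (i % b) < b
    1+r<b = ≤∧≢⇒< (m%n<n i b) λ eq → b∤1+i (divides (suc (i / b))
      (trans (cong suc (m≡m%n+[m/n]*n i b)) (cong (_+ i / b * b) eq)))
    quotient : suc i / b ≡ i / b
    quotient = begin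
      suc i / b                              ≡⟨ cong (λ j → suc j / b) (m≡m%n+[m/n]*n i b) ⟩
      (suc (i % b) + i / b * b) / b          ≡⟨ +-distrib-/-∣ʳ (suc (i % b)) (divides (i / b) refl) ⟩
      suc (i % b) / b + i / b * b / b        ≡⟨ cong₂ _+_ (m<n⇒m/n≡0 1+r<b) (m*n/n≡m (i / b) b) ⟩
      i / b                                  ∎

  windowSum : ℕ → ℕ → ℕ → ℕ
  windowSum b d u = sum (map (λ j → seqA b (suc u + j)) (upTo d))

  windowSum-suc : ∀ b d u → windowSum b (suc d) u ≡ windowSum b d u + seqA b (suc (u + d))
  windowSum-suc b d u = begin
    sum (map a (upTo (suc d)))                   ≡⟨ cong (λ xs → sum (map a xs)) (upTo-∷ʳ d) ⟨
    sum (map a (upTo d ++ d ∷ []))     ≡⟨ cong sum (map-++ a (upTo d) (d ∷ [])) ⟩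
    sum (map a (upTo d) ++ a d ∷ [])   ≡⟨ sum-++ (map a (upTo d)) (a d ∷ []) ⟩
    windowSum b d u + (a d + 0)                  ≡⟨ cong (windowSum b d u +_) (+-identityʳ (a d)) ⟩
    windowSum b d u + a d                        ∎
    where
    open ≡-Reasoning
    a : ℕ → ℕ
    a j = seqA b (suc u + j)

  -- The odd numbers 2i + 1 add up to a difference of squares, and the increments of ⌊i/b⌋
  -- telescope.
  windowSum-telescopes : ∀ b .{{_ : NonZero b}} d u → windowSum b d u + u / b ≡ φ d u + (u + d) / b
  windowSum-telescopes b zero    u = cong (_/ b) (sym (+-identityʳ u))
  windowSum-telescopes b (suc d) u = +-cancelʳ-≡ ((u + d) / b) _ _ (begin
    windowSum b (suc d) u + u / b + q             ≡⟨ cong (λ s → s + u / b + q) (windowSum-suc b d u) ⟩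
    windowSum b d u + a + u / b + q               ≡⟨ rearrange₁ (windowSum b d u) a (u / b) q ⟩
    (windowSum b d u + u / b) + (a + q)
      ≡⟨ cong₂ _+_ (windowSum-telescopes b d u) (seqA-step b (u + d)) ⟩
    φ d u + q + (2 * (u + d) + 1 + q′)            ≡⟨ rearrange₂ d u q q′ ⟩
    φ (suc d) u + q′ + q                          ≡⟨ cong (λ s → φ (suc d) u + s / b + q) (sym (+-suc u d)) ⟩
    φ (suc d) u + (u + suc d) / b + q             ∎)
    where
    open ≡-Reasoning
    a = seqA b (suc (u + d))
    q = (u + d) / b
    q′ = suc (u + d) / b
    rearrange₁ : ∀ s a p q → s + a + p + q ≡ (s + p) + (a + q)
    rearrange₁ = solve-∀
    rearrange₂ : ∀ d u q q′ → d * (2 * u + d) + q + (2 * (u + d) + 1 + q′) ≡ suc d * (2 * u + suc d) + q′ + q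
    rearrange₂ = solve-∀

  /-carry : ∀ b .{{_ : NonZero b}} m n → ∃ λ e → e < 2 × (m + n) / b ≡ m / b + (n / b + e)
  /-carry b m n = (m % b + n % b) / b , m<n*o⇒m/o<n carry<2b , (begin
    (m + n) / b
      ≡⟨ cong₂ (λ s t → (s + t) / b) (m≡m%n+[m/n]*n m b) (m≡m%n+[m/n]*n n b) ⟩
    (m % b + m / b * b + (n % b + n / b * b)) / b
      ≡⟨ cong (_/ b) (rearrange (m % b) (m / b) (n % b) (n / b) b) ⟩
    ((m / b + n / b) * b + (m % b + n % b)) / b
      ≡⟨ +-distrib-/-∣ˡ (m % b + n % b) (divides (m / b + n / b) refl) ⟩
    (m / b + n / b) * b / b + (m % b + n % b) / b
      ≡⟨ cong (_+ (m % b + n % b) / b) (m*n/n≡m (m / b + n / b) b) ⟩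
    m / b + n / b + (m % b + n % b) / b                      ≡⟨ +-assoc (m / b) (n / b) _ ⟩
    m / b + (n / b + (m % b + n % b) / b)                    ∎)
    where
    open ≡-Reasoning
    rearrange : ∀ r p s q b → r + p * b + (s + q * b) ≡ (p + q) * b + (r + s)
    rearrange = solve-∀
    carry<2b : m % b + n % b < 2 * b
    carry<2b = <-≤-trans (+-mono-< (m%n<n m b) (m%n<n n b)) (≤-reflexive (cong (b +_) (sym (+-identityʳ b))))

  -- Splitting ⌊(u + d)/b⌋ cancels ⌊u/b⌋, so beyond φ the starting point matters only through the
  -- carry.
  windowSum-form : ∀ b .{{_ : NonZero b}} d u → ∃ λ e → e < 2 × windowSum b d u ≡ φ d u + (d / b + e)
  windowSum-form b d u with e , e<2 , eq ← /-carry b u d =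
    e , e<2 , +-cancelʳ-≡ (u / b) _ _ (begin
      windowSum b d u + u / b         ≡⟨ windowSum-telescopes b d u ⟩
      φ d u + (u + d) / b             ≡⟨ cong (φ d u +_) eq ⟩
      φ d u + (u / b + (d / b + e))   ≡⟨ rearrange (φ d u) (u / b) (d / b + e) ⟩
      φ d u + (d / b + e) + u / b     ∎)
    where
    open ≡-Reasoning
    rearrange : ∀ p q r → p + (q + r) ≡ p + r + q
    rearrange = solve-∀

  windowSum-∈ : ∀ b n d u → 0 < d → u + d ≤ n → windowSum b d u ∈ consecSumList (seqA b) n
  windowSum-∈ b n (suc d) u _ u+d≤n =
    subst (_∈ consecSumList (seqA b) n)
      -- The window ends at v = `suc u + d`; its number of terms `suc v ∸ suc u` has to be
      -- identified with `suc d`.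
      (cong (λ l → sum (map (λ j → seqA b (suc u + j)) (upTo l)))
        (trans (cong (_∸ u) (sym (+-suc u d))) (m+n∸m≡n u (suc d))))
      (∈-concatMap⁺ (λ u → map (λ v → sumFromTo (seqA b) u v) (map (u +_) (upTo (suc n ∸ u))))
        (lose (∈-map⁺ suc (∈-upTo⁺ (≤-trans (m≤m+n (suc u) d) 1+u+d≤n)))
          (∈-map⁺ (sumFromTo (seqA b) (suc u)) (∈-map⁺ (suc u +_) (∈-upTo⁺ d<n∸u)))))
    where
    1+u+d≤n : suc u + d ≤ n
    1+u+d≤n = ≤-trans (≤-reflexive (sym (+-suc u d))) u+d≤n
    d<n∸u : d < n ∸ u
    d<n∸u = m+n≤o⇒m≤o∸n (suc d) (≤-trans (≤-reflexive (+-comm (suc d) u)) u+d≤n)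

  -- Choice of parameters and the quadratic bound.

  power-of-two-above : ∀ n → 0 < n → ∃ λ k → n ≤ 2 ^ k × 2 ^ k < 2 * n
  power-of-two-above (suc zero)    _ = 0 , ≤-refl , s≤s (s≤s z≤n)
  power-of-two-above (suc n@(suc _)) _ with k , n≤2^k , 2^k<2n ← power-of-two-above n z<s with suc n ≤? 2 ^ k
  ... | yes p = k , p , <-trans 2^k<2n (*-monoʳ-< 2 (n<1+n n))
  ... | no ¬p = suc k , ≤-trans (+-mono-≤ {1} {n} (s≤s z≤n) (m≤m+n n 0)) (*-monoʳ-≤ 2 n≤2^k) , *-monoʳ-< 2 (≰⇒> ¬p)

  -- If k exceeded 2m, then 2ᵏ would be at least 2 · 4ᵐ ≥ 2n. This turns the logarithmic hypotheses
  -- into bounds on the number k of doublings.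
  exponent-bound : ∀ {k n} m → 2 ^ k < 2 * n → n ≤ 4 ^ m → k ≤ 2 * m
  exponent-bound {k} {n} m 2^k<2n n≤4^m = ≮⇒≥ λ 2m<k → <⇒≱ 2^k<2n (begin
    2 * n           ≤⟨ *-monoʳ-≤ 2 n≤4^m ⟩
    2 * 4 ^ m       ≡⟨ cong (2 *_) (^-*-assoc 2 2 m) ⟩
    2 ^ suc (2 * m) ≤⟨ ^-monoʳ-≤ 2 2m<k ⟩
    2 ^ k           ∎)
    where open ≤-Reasoning

  cardS-quadratic : ∀ n b m .{{_ : NonZero b}} .{{_ : NonZero m}} → 3 ≤ n → n ≤ 4 ^ b → n ≤ 4 ^ m → b * m ≤ 2 * n →
                    n * n ≤ 450000 * cardS (seqA b) n
  cardS-quadratic n b m 3≤n n≤4^b n≤4^m bm≤2n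
    = begin
      n * n                           ≤⟨ *-mono-≤ n≤5N n≤5N ⟩
      (5 * N) * (5 * N)               ≡⟨ square 5 N ⟩
      25 * (N * N)                    ≤⟨ *-monoʳ-≤ 25 N²≤18000D ⟩
      25 * (18000 * cardS (seqA b) n) ≡⟨ *-assoc 25 18000 (cardS (seqA b) n) ⟨
      450000 * cardS (seqA b) n       ∎
    where
    open ≤-Reasoning
    power = power-of-two-above n (≤-trans z<s 3≤n)
    k = proj₁ power
    n≤T = proj₁ (proj₂ power)
    T<2n = proj₂ (proj₂ power)
    -- Starting points below N and lengths below 2N keep every window within the first n terms.
    N = n / 3
    T = 2 ^ k
    Q = (N + N) / b + 1
    square : ∀ a N → (a * N) * (a * N) ≡ (a * a) * (N * N)
    square = solve-∀
    0<N : 0 < N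
    0<N = m≥n⇒m/n>0 3≤n
    3N≤n : N * 3 ≤ n
    3N≤n = m/n*n≤m n 3
    n≤5N : n ≤ 5 * N
    n≤5N = begin
      n               ≡⟨ m≡m%n+[m/n]*n n 3 ⟩
      n % 3 + N * 3   ≤⟨ +-monoˡ-≤ (N * 3) (≤-trans (s≤s⁻¹ (m%n<n n 3)) (*-monoʳ-≤ 2 0<N)) ⟩
      2 * N + N * 3   ≡⟨ five N ⟩
      5 * N           ∎
      where
      five : ∀ N → 2 * N + N * 3 ≡ 5 * N
      five = solve-∀
    2N≤n : N + N ≤ n
    2N≤n = ≤-trans (≤-trans (m≤m+n (N + N) N) (≤-reflexive (three N))) 3N≤n
      where
      three : ∀ N → N + N + N ≡ N * 3
      three = solve-∀
    2N≤Qb : N + N ≤ Q * b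
    2N≤Qb = begin
      N + N                               ≡⟨ m≡m%n+[m/n]*n (N + N) b ⟩
      (N + N) % b + (N + N) / b * b       ≤⟨ +-monoˡ-≤ _ (m%n≤n (N + N) b) ⟩
      b + (N + N) / b * b                 ≡⟨ cong (_* b) (+-comm 1 ((N + N) / b)) ⟩
      Q * b                               ∎
    b≤2n : b ≤ 2 * n
    b≤2n = ≤-trans (m≤m*n b m) bm≤2n
    Qb≤3n : Q * b ≤ 3 * n
    Qb≤3n = begin
      Q * b                     ≡⟨ cong (_* b) (+-comm ((N + N) / b) 1) ⟩
      b + (N + N) / b * b       ≤⟨ +-mono-≤ b≤2n (≤-trans (m/n*n≤m (N + N) b) 2N≤n) ⟩
      2 * n + n                 ≡⟨ +-comm (2 * n) n ⟩
      3 * n                     ∎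
    k≤2b : k ≤ 2 * b
    k≤2b = exponent-bound b T<2n n≤4^b
    k≤2m : k ≤ 2 * m
    k≤2m = exponent-bound m T<2n n≤4^m
    0<Q : 1 ≤ Q
    0<Q = m≤n+m 1 ((N + N) / b)
    ∑H≤30n : ∑< T (H Q b) ≤ 30 * n
    ∑H≤30n = begin
      ∑< T (H Q b)                                                   ≤⟨ m≤m+n _ _ ⟩
      ∑< T (H Q b) + 2 * (Q * (b /2^ k))                             ≤⟨ ∑H-dyadic Q b k ⟩
      (Q + 1) * (b + 1) + 2 * (Q * b) + k * (Q + b) + T
        ≡⟨ cong (λ s → (Q + 1) * (b + 1) + 2 * (Q * b) + s + T) (*-distribˡ-+ k Q b) ⟩
      (Q + 1) * (b + 1) + 2 * (Q * b) + (k * Q + k * b) + T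
        -- The factor k is bounded in two ways: by 2b next to Q, since Qb = O(n), and by 2m next to
        -- b, since bm = O(n).
        ≤⟨ +-mono-≤ (+-mono-≤ (+-monoˡ-≤ (2 * (Q * b))
                                                                          (*-mono-≤ (+-monoʳ-≤ Q 0<Q) (+-monoʳ-≤ b (>-nonZero⁻¹ b))))
                                                                          (+-mono-≤ (*-monoˡ-≤ Q k≤2b) (*-monoˡ-≤ b k≤2m))) (<⇒≤ T<2n) ⟩
      (Q + Q) * (b + b) + 2 * (Q * b) + (2 * b * Q + 2 * m * b) + 2 * n ≡⟨ collect Q b m n ⟩
      8 * (Q * b) + 2 * (b * m) + 2 * n
        ≤⟨ +-monoˡ-≤ (2 * n) (+-mono-≤ (*-monoʳ-≤ 8 Qb≤3n) (*-monoʳ-≤ 2 bm≤2n)) ⟩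
      8 * (3 * n) + 2 * (2 * n) + 2 * n                              ≡⟨ total n ⟩
      30 * n                                                         ∎
      where
      collect : ∀ Q b m n → (Q + Q) * (b + b) + 2 * (Q * b) + (2 * b * Q + 2 * m * b) + 2 * n ≡ 8 * (Q * b) + 2 * (b * m) + 2 * n
      collect = solve-∀
      total : ∀ n → 8 * (3 * n) + 2 * (2 * n) + 2 * n ≡ 30 * n
      total = solve-∀
    E = energy (grid N) (gridValue N (windowSum b))
    N+T≤3n : N + T ≤ 3 * n
    N+T≤3n = +-mono-≤ (m/n≤m n 3) (<⇒≤ T<2n)
    E-small : E ≤ 18000 * (N * N)
    E-small = begin
      E
        ≤⟨ energy-bound b N T Q 0<N (≤-trans 2N≤n n≤T) 2N≤Qb (windowSum b) (windowSum-form b) ⟩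
      4 * (2 * (N + T) * ∑< T (H Q b))
        -- From n ≤ 5N come N + T ≤ 15N and the bound 150N for the sum of H, whence 18000 = 4 · 2 ·
        -- 15 · 150.
        ≤⟨ *-monoʳ-≤ 4 (*-mono-≤ (*-monoʳ-≤ 2 (≤-trans N+T≤3n (*-monoʳ-≤ 3 n≤5N)))
                                                                          (≤-trans ∑H≤30n (*-monoʳ-≤ 30 n≤5N))) ⟩
      4 * (2 * (3 * (5 * N)) * (30 * (5 * N)))     ≡⟨ regroup 4 2 3 5 30 N ⟩
      18000 * (N * N)                              ∎
      where
      regroup : ∀ p q r s t N →
                p * (q * (r * (s * N)) * (t * (s * N))) ≡ p * (q * (r * s) * (t * s)) * (N * N)
      regroup = solve-∀
    N²≤18000D : N * N ≤ 18000 * cardS (seqA b) n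
    N²≤18000D = subst (_≤ 18000 * cardS (seqA b) n) size
      (few-coincidences⇒large-image (grid N) (gridValue N (windowSum b))
        (deduplicate-! (consecSumList (seqA b) n)) member 18000
        (subst (λ l → E ≤ 18000 * l) (sym size) E-small))
      where
      size : length (grid N) ≡ N * N
      size = trans (length-cartesianProduct (downFrom N) (downFrom N))
        (cong₂ _*_ (length-downFrom N) (length-downFrom N))
      member : ∀ {p} → p ∈ grid N → gridValue N (windowSum b) p ∈ deduplicate _≟_ (consecSumList (seqA b) n)
      member {i , u} p∈ with i∈ , u∈ ← ∈-cartesianProduct⁻ (downFrom N) (downFrom N) p∈ =
        ∈-deduplicate⁺ _≟_ (windowSum-∈ b n (N + i) u (≤-trans 0<N (m≤m+n N i)) (begin
          u + (N + i)  ≤⟨ +-mono-≤ (<⇒≤ (∈-downFrom⁻ u∈)) (+-monoʳ-≤ N (<⇒≤ (∈-downFrom⁻ i∈))) ⟩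
          N + (N + N)  ≡⟨ three N ⟩
          N * 3        ≤⟨ 3N≤n ⟩
          n            ∎))
        where
        three : ∀ N → N + (N + N) ≡ N * 3
        three = solve-∀

open ConsecutiveSums using (windowSum-∈; cardS-quadratic)

open import Data.Nat using (ℕ; zero; suc; z≤n; s≤s; NonZero; _≤_; _^_; _/_)
import Data.Nat.Properties as ℕ
open import Data.Nat.DivMod using (m≡m%n+[m/n]*n; m%n≤n; m/n*n≤m)
open import Data.Integer as ℤ using (+_; -[1+_])
import Data.Integer.Properties as ℤ
open import Data.Rational using (ℚ; mkℚ; 0ℚ; 1ℚ; _<_; _*_; NonNegative)
import Data.Rational as ℚ
import Data.Rational.Properties as ℚ
import Data.Rational.Unnormalised as ℚᵘ
import Data.Rational.Unnormalised.Properties as ℚᵘ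
open import Data.Rational.Solver using (module +-*-Solver)

-- Negative binomial series at ½.

-- negBinom m k is the coefficient of xᵏ in (1 − x)⁻ᵐ.
negBinom : ℕ → ℕ → ℕ
negBinom zero    zero    = 1
negBinom zero    (suc k) = 0
negBinom (suc m) zero    = 1
negBinom (suc m) (suc k) = negBinom m (suc k) ℕ.+ negBinom (suc m) k

negBinom-0 : ∀ m → negBinom m 0 ≡ 1
negBinom-0 zero    = refl
negBinom-0 (suc m) = refl

-- Since `negBinom m k` is the binomial coefficient C(m + k - 1, k) for m ≥ 1, these are the
-- absorption identities. They are proved together from the Pascal-type recursion, without
-- factorials.
negBinom-sucˡ : ∀ m k → m ℕ.* negBinom (suc m) k ≡ (m ℕ.+ k) ℕ.* negBinom m k
negBinom-sucʳ : ∀ m k → suc k ℕ.* negBinom m (suc k) ≡ (m ℕ.+ k) ℕ.* negBinom m k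

negBinom-sucˡ m zero    = cong₂ ℕ._*_ (sym (ℕ.+-identityʳ m)) (sym (negBinom-0 m))
negBinom-sucˡ m (suc k) = begin
  m ℕ.* (x ℕ.+ negBinom (suc m) k)               ≡⟨ ℕ.*-distribˡ-+ m x _ ⟩
  m ℕ.* x ℕ.+ m ℕ.* negBinom (suc m) k           ≡⟨ cong (m ℕ.* x ℕ.+_) (negBinom-sucˡ m k) ⟩
  m ℕ.* x ℕ.+ (m ℕ.+ k) ℕ.* negBinom m k         ≡⟨ cong (m ℕ.* x ℕ.+_) (negBinom-sucʳ m k) ⟨
  m ℕ.* x ℕ.+ suc k ℕ.* x                        ≡⟨ ℕ.*-distribʳ-+ x m (suc k) ⟨
  (m ℕ.+ suc k) ℕ.* x                            ∎
  where
  open ≡-Reasoning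
  x = negBinom m (suc k)

negBinom-sucʳ zero    zero    = refl
negBinom-sucʳ zero    (suc k) = trans (ℕ.*-zeroʳ k) (sym (ℕ.*-zeroʳ k))
negBinom-sucʳ (suc m) k       = begin
  suc k ℕ.* (negBinom m (suc k) ℕ.+ y)           ≡⟨ ℕ.*-distribˡ-+ (suc k) _ y ⟩
  suc k ℕ.* negBinom m (suc k) ℕ.+ suc k ℕ.* y   ≡⟨ cong (ℕ._+ suc k ℕ.* y) (negBinom-sucʳ m k) ⟩
  (m ℕ.+ k) ℕ.* negBinom m k ℕ.+ suc k ℕ.* y     ≡⟨ cong (ℕ._+ suc k ℕ.* y) (negBinom-sucˡ m k) ⟨
  m ℕ.* y ℕ.+ suc k ℕ.* y                        ≡⟨ ℕ.*-distribʳ-+ y m (suc k) ⟨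
  (m ℕ.+ suc k) ℕ.* y                            ≡⟨ cong (ℕ._* y) (ℕ.+-suc m k) ⟩
  (suc m ℕ.+ k) ℕ.* y                            ∎
  where
  open ≡-Reasoning
  y = negBinom (suc m) k

-- 2ᴷ times the K-th partial sum of (1 − x)⁻ᵐ at x = ½.
halfSum : ℕ → ℕ → ℕ
halfSum m zero    = negBinom m 0
halfSum m (suc K) = 2 ℕ.* halfSum m K ℕ.+ negBinom m (suc K)

-- Multiplication of the series for m + 1 by 1 - x gives the series for m; at x = ½ this is a
-- halving, and the added coefficient is the truncation error.
halfSum-suc : ∀ m K → halfSum (suc m) K ℕ.+ negBinom (suc m) K ≡ 2 ℕ.* halfSum m K
halfSum-suc m zero    = cong (2 ℕ.*_) (sym (negBinom-0 m))
halfSum-suc m (suc K) = begin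
  2 ℕ.* h ℕ.+ (x ℕ.+ y) ℕ.+ (x ℕ.+ y)   ≡⟨ rearrange h x y ⟩
  2 ℕ.* (h ℕ.+ y) ℕ.+ 2 ℕ.* x           ≡⟨ cong (λ s → 2 ℕ.* s ℕ.+ 2 ℕ.* x) (halfSum-suc m K) ⟩
  2 ℕ.* (2 ℕ.* halfSum m K) ℕ.+ 2 ℕ.* x ≡⟨ ℕ.*-distribˡ-+ 2 (2 ℕ.* halfSum m K) x ⟨
  2 ℕ.* (2 ℕ.* halfSum m K ℕ.+ x)       ∎
  where
  open ≡-Reasoning
  h = halfSum (suc m) K
  x = negBinom m (suc K)
  y = negBinom (suc m) K
  rearrange : ∀ h x y → 2 ℕ.* h ℕ.+ (x ℕ.+ y) ℕ.+ (x ℕ.+ y) ≡ 2 ℕ.* (h ℕ.+ y) ℕ.+ 2 ℕ.* x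
  rearrange = solve-∀

-- The full series at ½ has the value 2ᵐ. The induction on m drops the nonnegative truncation error.
halfSum≤2^ : ∀ m K → halfSum m K ≤ 2 ^ m ℕ.* 2 ^ K
halfSum≤2^ zero    zero    = ℕ.≤-refl
halfSum≤2^ zero    (suc K) = ℕ.≤-trans
  (ℕ.≤-reflexive (ℕ.+-identityʳ (2 ℕ.* halfSum 0 K)))
  (ℕ.≤-trans (ℕ.*-monoʳ-≤ 2 (halfSum≤2^ 0 K)) (ℕ.≤-reflexive (swap (2 ^ K))))
  where
  swap : ∀ p → 2 ℕ.* (1 ℕ.* p) ≡ 1 ℕ.* (2 ℕ.* p)
  swap = solve-∀
halfSum≤2^ (suc m) K = begin
  halfSum (suc m) K                           ≤⟨ ℕ.m≤m+n _ _ ⟩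
  halfSum (suc m) K ℕ.+ negBinom (suc m) K    ≡⟨ halfSum-suc m K ⟩
  2 ℕ.* halfSum m K                           ≤⟨ ℕ.*-monoʳ-≤ 2 (halfSum≤2^ m K) ⟩
  2 ℕ.* (2 ^ m ℕ.* 2 ^ K)                     ≡⟨ ℕ.*-assoc 2 (2 ^ m) (2 ^ K) ⟨
  2 ^ suc m ℕ.* 2 ^ K                         ∎
  where open ℕ.≤-Reasoning

-- The embedding of ℕ in ℚ.

coprime-1 : ∀ n → Coprime n 1
coprime-1 n = Coprimality.sym (Coprimality.1-coprimeTo n)

-- The normalising division does not reduce for a variable n; in this explicit form the operations
-- and the order on ℚ compute.
ℕ→ℚ-mkℚ : ∀ n → ℕ→ℚ n ≡ mkℚ (+ n) 0 (coprime-1 n)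
ℕ→ℚ-mkℚ n = ℚ.↥p/↧p≡p (mkℚ (+ n) 0 (coprime-1 n))

ℕ→ℚ-homo-* : ∀ m n → ℕ→ℚ (m ℕ.* n) ≡ ℕ→ℚ m * ℕ→ℚ n
ℕ→ℚ-homo-* m n rewrite ℕ→ℚ-mkℚ m | ℕ→ℚ-mkℚ n = cong (ℚ._/ 1) (ℤ.pos-* m n)

ℕ→ℚ-homo-+ : ∀ m n → ℕ→ℚ (m ℕ.+ n) ≡ ℕ→ℚ m ℚ.+ ℕ→ℚ n
ℕ→ℚ-homo-+ m n rewrite ℕ→ℚ-mkℚ m | ℕ→ℚ-mkℚ n =
  cong (ℚ._/ 1) (trans (ℤ.pos-+ m n) (sym (cong₂ ℤ._+_ (ℤ.*-identityʳ (+ m)) (ℤ.*-identityʳ (+ n)))))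

ℕ→ℚ-mono-≤ : ∀ {m n} → m ≤ n → ℕ→ℚ m ℚ.≤ ℕ→ℚ n
ℕ→ℚ-mono-≤ {m} {n} m≤n rewrite ℕ→ℚ-mkℚ m | ℕ→ℚ-mkℚ n =
  ℚ.*≤* (ℤ.*-monoʳ-≤-nonNeg (+ 1) (ℤ.+≤+ m≤n))

ℕ→ℚ-cancel-≤ : ∀ {m n} → ℕ→ℚ m ℚ.≤ ℕ→ℚ n → m ≤ n
ℕ→ℚ-cancel-≤ {m} {n} le rewrite ℕ→ℚ-mkℚ m | ℕ→ℚ-mkℚ n =
  ℤ.drop‿+≤+ (ℤ.*-cancelʳ-≤-pos (+ m) (+ n) (+ 1) (ℚ.drop-*≤* le))

ℕ→ℚ-nonNeg : ∀ n → NonNegative (ℕ→ℚ n)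
ℕ→ℚ-nonNeg n = ℚ.normalize-nonNeg n 1

/-*-cancel : ∀ i d .{{_ : NonZero d}} → (+ i ℚ./ d) * ℕ→ℚ d ≡ ℕ→ℚ i
/-*-cancel i d@(suc d-1) = ℚ.toℚᵘ-injective (begin
  ℚ.toℚᵘ ((+ i ℚ./ d) * ℕ→ℚ d)                   ≈⟨ ℚ.toℚᵘ-homo-* (+ i ℚ./ d) (ℕ→ℚ d) ⟩
  ℚ.toℚᵘ (+ i ℚ./ d) ℚᵘ.* ℚ.toℚᵘ (ℕ→ℚ d)
    ≈⟨ ℚᵘ.*-cong (ℚ.toℚᵘ-fromℚᵘ (ℚᵘ.mkℚᵘ (+ i) d-1)) (ℚ.toℚᵘ-fromℚᵘ (ℚᵘ.mkℚᵘ (+ d) 0)) ⟩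
  ℚᵘ.mkℚᵘ (+ i) d-1 ℚᵘ.* ℚᵘ.mkℚᵘ (+ d) 0
    ≈⟨ ℚᵘ.*≡* (trans (ℤ.*-identityʳ _) (cong (λ e → + i ℤ.* + e) (sym (ℕ.*-identityʳ d)))) ⟩
  ℚᵘ.mkℚᵘ (+ i) 0                                ≈⟨ ℚ.toℚᵘ-fromℚᵘ (ℚᵘ.mkℚᵘ (+ i) 0) ⟨
  ℚ.toℚᵘ (ℕ→ℚ i)                                 ∎)
  where open ℚᵘ.≃-Reasoning

*-mono-≤-nonNeg : ∀ {p q r s} → 0ℚ ℚ.≤ q → 0ℚ ℚ.≤ r → p ℚ.≤ q → r ℚ.≤ s → p * r ℚ.≤ q * s
*-mono-≤-nonNeg {p} {q} {r} {s} 0≤q 0≤r p≤q r≤s = ℚ.≤-trans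
  (ℚ.*-monoʳ-≤-nonNeg r {{ℚ.nonNegative 0≤r}} p≤q)
  (ℚ.*-monoˡ-≤-nonNeg q {{ℚ.nonNegative 0≤q}} r≤s)

0≤ℕ→ℚ : ∀ n → 0ℚ ℚ.≤ ℕ→ℚ n
0≤ℕ→ℚ n = ℚ.nonNegative⁻¹ (ℕ→ℚ n) {{ℕ→ℚ-nonNeg n}}

-- Exponential series against powers of 4.

module _ (q : ℚ) (m : ℕ) (0≤q : 0ℚ ℚ.≤ q) (q≤m : q ℚ.≤ ℕ→ℚ m) where

  private
    M = 2 ℕ.* m

  -- Compares the exponential series at q ≤ m with that of (1 − x)⁻²ᵐ at x = ½, term by term.
  expTerm-bound : ∀ k → ℕ→ℚ (2 ^ k) * expTerm q k ℚ.≤ ℕ→ℚ (negBinom M k)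
  expTerm-bound zero    = ℚ.≤-reflexive (trans (ℚ.*-identityʳ (ℕ→ℚ 1)) (cong ℕ→ℚ (sym (negBinom-0 M))))
  expTerm-bound (suc k) = begin
    ℕ→ℚ (2 ℕ.* 2 ^ k) * (t * q * i)                ≡⟨ cong (_* (t * q * i)) (ℕ→ℚ-homo-* 2 (2 ^ k)) ⟩
    ℕ→ℚ 2 * ℕ→ℚ (2 ^ k) * (t * q * i)              ≡⟨ rearrange (ℕ→ℚ 2) (ℕ→ℚ (2 ^ k)) t q i ⟩
    ℕ→ℚ (2 ^ k) * t * (ℕ→ℚ 2 * q) * i
      ≤⟨ ℚ.*-monoʳ-≤-nonNeg i {{ℚ.normalize-nonNeg 1 (suc k)}} product ⟩
    ℕ→ℚ (suc k ℕ.* x) * i                          ≡⟨ cong (_* i) (ℕ→ℚ-homo-* (suc k) x) ⟩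
    ℕ→ℚ (suc k) * ℕ→ℚ x * i
      ≡⟨ solve 3 (λ s x i → s :* x :* i := i :* s :* x) refl (ℕ→ℚ (suc k)) (ℕ→ℚ x) i ⟩
    i * ℕ→ℚ (suc k) * ℕ→ℚ x                        ≡⟨ cong (_* ℕ→ℚ x) (/-*-cancel 1 (suc k)) ⟩
    1ℚ * ℕ→ℚ x                                     ≡⟨ ℚ.*-identityˡ (ℕ→ℚ x) ⟩
    ℕ→ℚ x                                          ∎
    where
    open ℚ.≤-Reasoning
    open +-*-Solver
    t = expTerm q k
    i = + 1 ℚ./ suc k
    x = negBinom M (suc k)
    rearrange : ∀ a b t q i → a * b * (t * q * i) ≡ b * t * (a * q) * i
    rearrange = solve 5 (λ a b t q i → a :* b :* (t :* q :* i) := b :* t :* (a :* q) :* i) refl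
    2q≤M : ℕ→ℚ 2 * q ℚ.≤ ℕ→ℚ M
    2q≤M = ℚ.≤-trans (ℚ.*-monoˡ-≤-nonNeg (ℕ→ℚ 2) q≤m) (ℚ.≤-reflexive (sym (ℕ→ℚ-homo-* 2 m)))
    0≤2q : 0ℚ ℚ.≤ ℕ→ℚ 2 * q
    0≤2q = ℚ.≤-trans (ℚ.≤-reflexive (sym (ℚ.*-zeroʳ (ℕ→ℚ 2)))) (ℚ.*-monoˡ-≤-nonNeg (ℕ→ℚ 2) 0≤q)
    product : ℕ→ℚ (2 ^ k) * t * (ℕ→ℚ 2 * q) ℚ.≤ ℕ→ℚ (suc k ℕ.* x)
    product = begin
      ℕ→ℚ (2 ^ k) * t * (ℕ→ℚ 2 * q)
        ≤⟨ *-mono-≤-nonNeg (0≤ℕ→ℚ (negBinom M k)) 0≤2q (expTerm-bound k) 2q≤M ⟩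
      ℕ→ℚ (negBinom M k) * ℕ→ℚ M          ≡⟨ ℕ→ℚ-homo-* (negBinom M k) M ⟨
      -- The ratio of consecutive terms is at most M/(k + 1) on the exponential side and equals (M +
      -- k)/(k + 1) on the binomial side.
      ℕ→ℚ (negBinom M k ℕ.* M)            ≤⟨ ℕ→ℚ-mono-≤ (ℕ.≤-trans
                                               (ℕ.≤-trans (ℕ.≤-reflexive (ℕ.*-comm (negBinom M k) M)) (ℕ.*-monoˡ-≤ (negBinom M k) (ℕ.m≤m+n M k)))
                                               (ℕ.≤-reflexive (sym (negBinom-sucʳ M k)))) ⟩
      ℕ→ℚ (suc k ℕ.* x)                   ∎

  expPartial-bound : ∀ K → ℕ→ℚ (2 ^ K) * expPartial q K ℚ.≤ ℕ→ℚ (halfSum M K)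
  expPartial-bound zero    = expTerm-bound zero
  expPartial-bound (suc K) = begin
    ℕ→ℚ (2 ^ suc K) * (expPartial q K ℚ.+ expTerm q (suc K))
      ≡⟨ ℚ.*-distribˡ-+ (ℕ→ℚ (2 ^ suc K)) (expPartial q K) (expTerm q (suc K)) ⟩
    ℕ→ℚ (2 ^ suc K) * expPartial q K ℚ.+ ℕ→ℚ (2 ^ suc K) * expTerm q (suc K)
      ≤⟨ ℚ.+-mono-≤ doubled (expTerm-bound (suc K)) ⟩
    ℕ→ℚ (2 ℕ.* halfSum M K) ℚ.+ ℕ→ℚ (negBinom M (suc K))
      ≡⟨ ℕ→ℚ-homo-+ (2 ℕ.* halfSum M K) (negBinom M (suc K)) ⟨
    ℕ→ℚ (halfSum M (suc K)) ∎
    where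
    open ℚ.≤-Reasoning
    doubled : ℕ→ℚ (2 ^ suc K) * expPartial q K ℚ.≤ ℕ→ℚ (2 ℕ.* halfSum M K)
    doubled = begin
      ℕ→ℚ (2 ℕ.* 2 ^ K) * expPartial q K        ≡⟨ cong (_* expPartial q K) (ℕ→ℚ-homo-* 2 (2 ^ K)) ⟩
      ℕ→ℚ 2 * ℕ→ℚ (2 ^ K) * expPartial q K      ≡⟨ ℚ.*-assoc (ℕ→ℚ 2) (ℕ→ℚ (2 ^ K)) (expPartial q K) ⟩
      ℕ→ℚ 2 * (ℕ→ℚ (2 ^ K) * expPartial q K)    ≤⟨ ℚ.*-monoˡ-≤-nonNeg (ℕ→ℚ 2) (expPartial-bound K) ⟩
      ℕ→ℚ 2 * ℕ→ℚ (halfSum M K)                 ≡⟨ ℕ→ℚ-homo-* 2 (halfSum M K) ⟨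
      ℕ→ℚ (2 ℕ.* halfSum M K)                   ∎

  -- The bound 2ᴹ · 2ᴷ on `halfSum M K` holds for every K, so the scale 2ᴷ cancels whichever partial
  -- sum witnesses the hypothesis; and 2ᴹ = 4ᵐ.
  LogLe⇒≤4^ : ∀ {n} → LogLe n q → n ≤ 4 ^ m
  LogLe⇒≤4^ {n} (K , n≤E) = subst (n ≤_) (sym (ℕ.^-*-assoc 2 2 m))
    (ℕ.*-cancelˡ-≤ (2 ^ K) {{ℕ.m^n≢0 2 K}} (ℕ→ℚ-cancel-≤ (begin
      ℕ→ℚ (2 ^ K ℕ.* n)             ≡⟨ ℕ→ℚ-homo-* (2 ^ K) n ⟩
      ℕ→ℚ (2 ^ K) * ℕ→ℚ n           ≤⟨ ℚ.*-monoˡ-≤-nonNeg (ℕ→ℚ (2 ^ K)) {{ℕ→ℚ-nonNeg (2 ^ K)}} n≤E ⟩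
      ℕ→ℚ (2 ^ K) * expPartial q K  ≤⟨ expPartial-bound K ⟩
      ℕ→ℚ (halfSum M K)             ≤⟨ ℕ→ℚ-mono-≤ (halfSum≤2^ M K) ⟩
      ℕ→ℚ (2 ^ M ℕ.* 2 ^ K)         ≡⟨ cong ℕ→ℚ (ℕ.*-comm (2 ^ M) (2 ^ K)) ⟩
      ℕ→ℚ (2 ^ K ℕ.* 2 ^ M)         ∎)))
    where open ℚ.≤-Reasoning

-- From the rational upper condition to natural numbers.

nonNeg-fraction : ∀ q → 0ℚ ℚ.≤ q → ∃ λ a → ∃ λ d → q * ℕ→ℚ (suc d) ≡ ℕ→ℚ a
nonNeg-fraction (mkℚ (+ a) d c) _ =
  a , d , trans (cong (_* ℕ→ℚ (suc d)) (sym (ℚ.↥p/↧p≡p (mkℚ (+ a) d c)))) (/-*-cancel a (suc d))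
nonNeg-fraction (mkℚ -[1+ a ] d c) 0≤q with () ← ℚ.nonNegative 0≤q

fraction≤ : ∀ q a d m → q * ℕ→ℚ (suc d) ≡ ℕ→ℚ a → a ≤ m ℕ.* suc d → q ℚ.≤ ℕ→ℚ m
fraction≤ q a d m eq a≤md = ℚ.*-cancelʳ-≤-pos (ℕ→ℚ (suc d)) {{ℚ.normalize-pos (suc d) 1}} (begin
  q * ℕ→ℚ (suc d)        ≡⟨ eq ⟩
  ℕ→ℚ a                  ≤⟨ ℕ→ℚ-mono-≤ a≤md ⟩
  ℕ→ℚ (m ℕ.* suc d)      ≡⟨ ℕ→ℚ-homo-* m (suc d) ⟩
  ℕ→ℚ m * ℕ→ℚ (suc d)    ∎)
  where open ℚ.≤-Reasoning

-- Take m = ⌊q⌋ + 1, so that q ≤ m. As n > 4, the bound n ≤ 4 that q ≤ 1 would give is excluded;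
-- hence q ≥ 1, m ≤ 2q, and bm ≤ 2bq ≤ 2bq² ≤ 2n. The computation is carried out with q = a/d and
-- cleared denominators.
UpperCond⇒ : ∀ n b → 4 ℕ.< n → UpperCond n b → ∃ λ m → 0 ℕ.< m × n ≤ 4 ^ m × b ℕ.* m ≤ 2 ℕ.* n
UpperCond⇒ n b 4<n (q , 0≤q , bq²≤n , log≤q) =
  m , s≤s z≤n , LogLe⇒≤4^ q m 0≤q (fraction≤ q a d-1 m qd≡a a≤md) log≤q , bm≤2n
  where
  fraction = nonNeg-fraction q 0≤q
  a = proj₁ fraction
  d-1 = proj₁ (proj₂ fraction)
  qd≡a = proj₂ (proj₂ fraction)
  d = suc d-1
  m = suc (a / d)
  a≤md : a ≤ m ℕ.* d
  a≤md = ℕ.≤-trans (ℕ.≤-reflexive (m≡m%n+[m/n]*n a d)) (ℕ.+-monoˡ-≤ (a / d ℕ.* d) (m%n≤n a d))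
  d≤a : d ≤ a
  d≤a = ℕ.≮⇒≥ λ a<d → ℕ.<⇒≱ 4<n (LogLe⇒≤4^ q 1 0≤q
    (fraction≤ q a d-1 1 qd≡a (ℕ.≤-trans (ℕ.<⇒≤ a<d) (ℕ.≤-reflexive (sym (ℕ.*-identityˡ d))))) log≤q)
  baa≤ndd : b ℕ.* a ℕ.* a ≤ n ℕ.* d ℕ.* d
  baa≤ndd = ℕ→ℚ-cancel-≤ (begin
    ℕ→ℚ (b ℕ.* a ℕ.* a)                       ≡⟨ homo₃ b a ⟩
    ℕ→ℚ b * ℕ→ℚ a * ℕ→ℚ a                     ≡⟨ cong (λ s → ℕ→ℚ b * s * s) qd≡a ⟨
    ℕ→ℚ b * (q * ℕ→ℚ d) * (q * ℕ→ℚ d)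
      ≡⟨ solve 3 (λ b q d → b :* (q :* d) :* (q :* d) := b :* q :* q :* d :* d) refl (ℕ→ℚ b) q (ℕ→ℚ d) ⟩
    ℕ→ℚ b * q * q * ℕ→ℚ d * ℕ→ℚ d
      ≤⟨ ℚ.*-monoʳ-≤-nonNeg (ℕ→ℚ d) {{ℕ→ℚ-nonNeg d}} (ℚ.*-monoʳ-≤-nonNeg (ℕ→ℚ d) {{ℕ→ℚ-nonNeg d}} bq²≤n) ⟩
    ℕ→ℚ n * ℕ→ℚ d * ℕ→ℚ d                     ≡⟨ homo₃ n d ⟨
    ℕ→ℚ (n ℕ.* d ℕ.* d)                       ∎)
    where
    open ℚ.≤-Reasoning
    open +-*-Solver
    homo₃ : ∀ x y → ℕ→ℚ (x ℕ.* y ℕ.* y) ≡ ℕ→ℚ x * ℕ→ℚ y * ℕ→ℚ y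
    homo₃ x y = trans (ℕ→ℚ-homo-* (x ℕ.* y) y) (cong (_* ℕ→ℚ y) (ℕ→ℚ-homo-* x y))
  bm≤2n : b ℕ.* m ≤ 2 ℕ.* n
  bm≤2n = ℕ.*-cancelʳ-≤ (b ℕ.* m) (2 ℕ.* n) (d ℕ.* d) (begin
    b ℕ.* m ℕ.* (d ℕ.* d)             ≡⟨ regroup₁ b m d ⟩
    -- The inequality q ≥ 1, as d ≤ a, is used twice: for md ≤ 2a and to replace the other d by a.
    b ℕ.* (m ℕ.* d) ℕ.* d             ≤⟨ ℕ.*-mono-≤ (ℕ.*-monoʳ-≤ b (ℕ.+-mono-≤ d≤a (m/n*n≤m a d))) d≤a ⟩
    b ℕ.* (a ℕ.+ a) ℕ.* a             ≡⟨ regroup₂ b a ⟩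
    2 ℕ.* (b ℕ.* a ℕ.* a)             ≤⟨ ℕ.*-monoʳ-≤ 2 baa≤ndd ⟩
    2 ℕ.* (n ℕ.* d ℕ.* d)             ≡⟨ regroup₃ n d ⟩
    2 ℕ.* n ℕ.* (d ℕ.* d)             ∎)
    where
    open ℕ.≤-Reasoning
    regroup₁ : ∀ b m d → b ℕ.* m ℕ.* (d ℕ.* d) ≡ b ℕ.* (m ℕ.* d) ℕ.* d
    regroup₁ = solve-∀
    regroup₂ : ∀ b a → b ℕ.* (a ℕ.+ a) ℕ.* a ≡ 2 ℕ.* (b ℕ.* a ℕ.* a)
    regroup₂ = solve-∀
    regroup₃ : ∀ n d → 2 ℕ.* (n ℕ.* d ℕ.* d) ≡ 2 ℕ.* n ℕ.* (d ℕ.* d)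
    regroup₃ = solve-∀

-- Small n and the rational constant.

∈⇒0<length : ∀ {x : ℕ} {xs} → x ∈ xs → 0 ℕ.< length xs
∈⇒0<length {xs = _ ∷ _} _ = s≤s z≤n

cardS-positive : ∀ n b → 1 ≤ n → 0 ℕ.< cardS (seqA b) n
cardS-positive n b 1≤n = ∈⇒0<length (∈-deduplicate⁺ ℕ._≟_ (windowSum-∈ b n 1 0 (s≤s z≤n) 1≤n))

n²≤cardS : ∀ n b → 1 ≤ n → 1 ≤ b → LogLe n (ℕ→ℚ b) → UpperCond n b →
           n ℕ.* n ≤ 450000 ℕ.* cardS (seqA b) n
n²≤cardS n b 1≤n 1≤b log≤b upper = by-size (n ℕ.≤? 4)
  where
  by-size : Dec (n ≤ 4) → n ℕ.* n ≤ 450000 ℕ.* cardS (seqA b) n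
  -- Here n² ≤ 16, so it is enough that some consecutive sum exists.
  by-size (yes n≤4) = ℕ.≤-trans (ℕ.*-mono-≤ n≤4 n≤4) (ℕ.*-mono-≤ (ℕ.≤ᵇ⇒≤ 16 450000 _) (cardS-positive n b 1≤n))
  by-size (no n≰4)  =
    let 4<n = ℕ.≰⇒> n≰4
        m , 0<m , n≤4^m , bm≤2n = UpperCond⇒ n b 4<n upper
    in cardS-quadratic n b m {{ℕ.>-nonZero 1≤b}} {{ℕ.>-nonZero 0<m}} (ℕ.<⇒≤ (ℕ.<-trans (ℕ.n<1+n 3) 4<n))
         -- The lower condition on b is the case q = m = b.
         (LogLe⇒≤4^ (ℕ→ℚ b) b (0≤ℕ→ℚ b) ℚ.≤-refl log≤b) n≤4^m bm≤2n

scaled-≤ : ∀ t .{{_ : NonZero t}} n D → n ℕ.* n ≤ t ℕ.* D →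
           (+ 1 ℚ./ t) * (ℕ→ℚ n * ℕ→ℚ n) ℚ.≤ ℕ→ℚ D
scaled-≤ t n D n²≤tD = begin
  (+ 1 ℚ./ t) * (ℕ→ℚ n * ℕ→ℚ n)   ≡⟨ cong ((+ 1 ℚ./ t) *_) (ℕ→ℚ-homo-* n n) ⟨
  (+ 1 ℚ./ t) * ℕ→ℚ (n ℕ.* n)
    ≤⟨ ℚ.*-monoˡ-≤-nonNeg (+ 1 ℚ./ t) {{ℚ.normalize-nonNeg 1 t}} (ℕ→ℚ-mono-≤ n²≤tD) ⟩
  (+ 1 ℚ./ t) * ℕ→ℚ (t ℕ.* D)     ≡⟨ cong ((+ 1 ℚ./ t) *_) (ℕ→ℚ-homo-* t D) ⟩
  (+ 1 ℚ./ t) * (ℕ→ℚ t * ℕ→ℚ D)   ≡⟨ ℚ.*-assoc (+ 1 ℚ./ t) (ℕ→ℚ t) (ℕ→ℚ D) ⟨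
  (+ 1 ℚ./ t) * ℕ→ℚ t * ℕ→ℚ D     ≡⟨ cong (_* ℕ→ℚ D) (/-*-cancel 1 t) ⟩
  1ℚ * ℕ→ℚ D                      ≡⟨ ℚ.*-identityˡ (ℕ→ℚ D) ⟩
  ℕ→ℚ D                           ∎
  where open ℚ.≤-Reasoning

theorem1p3 : Σ ℚ λ c₃ → (0ℚ < c₃) ×
    ((n b : ℕ) → 1 ≤ n → 1 ≤ b →
    LogLe n (ℕ→ℚ b) → UpperCond n b →
    c₃ * (ℕ→ℚ n * ℕ→ℚ n) ℚ.≤ ℕ→ℚ (cardS (seqA b) n))
theorem1p3 = + 1 ℚ./ 450000 ,
  ℚ.positive⁻¹ (+ 1 ℚ./ 450000) {{ℚ.normalize-pos 1 450000}} ,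
  λ n b 1≤n 1≤b log≤b upper →
    scaled-≤ 450000 n (cardS (seqA b) n) (n²≤cardS n b 1≤n 1≤b log≤b upper)
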